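{- Let $n\ge1$ and let $m_1,\dots,m_n$ be positive integers, and put $m_0=1$. Let $\Gamma=\mathbf C[m_n,m_{n-1},\dots,m_1,1]$ be the complete layered graph with $|V_i|=m_i$ for $0\le i\le n$. Then $$\frac{1-t}{H(A(\Gamma),t)}=1-\sum_{k=0}^n\sum_{a=k}^n(-1)^k\,m_a(m_{a-1}-1)(m_{a-2}-1)\cdots(m_{a-k+1}-1)m_{a-k}\,t^{k+1},$$ where for $k=1$ the term is $m_am_{a-1}$ (no factors $(m_j-1)$), and for $k=0$ the term is interpreted as $m_a$.
   Context: A layered directed graph $\Gamma=(V,E)$ has $V=\bigcup_{i=0}^nV_i$, $E=\bigcup_{i=1}^nE_i$, and tail/head maps $\mathbf t,\mathbf h:E\to V$ with $\mathbf t(E_i)\subseteq V_i$, $\mathbf h(E_i)\subseteq V_{i-1}$. It is complete if for every $1\le i\le n$ and every $v\in V_i$, $w\in V_{i-1}$ there is a unique edge $e$ with $\mathbf t(e)=v$, $\mathbf h(e)=w$; $\mathbf C[m_n,\dots,m_0]$ denotes the complete layered graph with $|V_i|=m_i$. A path $\pi=(e_1,\dots,e_m)$ is a sequence of edges with $\mathbf h(e_i)=\mathbf t(e_{i+1})$. Fix a field $F$, let $T(E)$ be the free associative $F$-algebra on $E$, put $P_\pi(\tau)=(\tau-e_1)\cdots(\tau-e_m)=\sum_{j=0}^m e(\pi,j)\tau^{m-j}$ ($\tau$ central), and let $R$ be the ideal generated by all $e(\pi_1,k)-e(\pi_2,k)$ for paths $\pi_1,\pi_2$ with common tail and common head and $1\le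 k\le$ length of $\pi_1$. $A(\Gamma)=T(E)/R$, graded with edges in degree $1$, and $H(A,t)=\sum_i\dim A_i\,t^i$. -}

module Defs where

open import Level using (Level; _⊔_) renaming (suc to lsuc)
open import Algebra.Bundles using (CommutativeRing)
open import Data.Nat as ℕ using (ℕ; zero; suc; _≤_; _∸_; _≤?_)
open import Data.Integer as ℤ using (ℤ; +_)
open import Data.Fin as Fin using (Fin; toℕ)
open import Data.Fin.Properties as FinP using ()
open import Data.List using (List; []; _∷_; _++_; map; concatMap; length; zipWith; allFin; foldl)
open import Data.List.Relation.Unary.All using (All)
open import Data.List.Properties as ListP using ()
open import Data.Product using (Σ; ∃; _×_; _,_; proj₁; proj₂)
open import Relation.Nullary using (¬_; yes; no)
open import Relation.Binary.PropositionalEquality using (_≡_; refl; cong)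
open import Relation.Binary.Definitions using (DecidableEquality)

record Field (c ℓ : Level) : Set (lsuc (c ⊔ ℓ)) where
  field
    commutativeRing : CommutativeRing c ℓ
  open CommutativeRing commutativeRing public
  field
    0≉1     : ¬ (0# ≈ 1#)
    inverse : ∀ x → ¬ (x ≈ 0#) → ∃ λ y → (x * y) ≈ 1#

sgn : ℕ → ℤ
sgn zero    = + 1
sgn (suc k) = ℤ.- sgn k

sumUpTo : ℕ → (ℕ → ℤ) → ℤ
sumUpTo zero    f = f 0
sumUpTo (suc N) f = sumUpTo N f ℤ.+ f (suc N)

-- Σ_{a=k}^{n} f a   (used only with k ≤ n)
sumFromTo : ℕ → ℕ → (ℕ → ℤ) → ℤ
sumFromTo k n f = sumUpTo (n ∸ k) (λ i → f (k ℕ.+ i))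

prod1To : ℕ → (ℕ → ℤ) → ℤ
prod1To zero    f = + 1
prod1To (suc K) f = prod1To K f ℤ.* f (suc K)

layer : (ℕ → ℕ) → ℕ → ℕ
layer m zero    = 1
layer m (suc i) = m (suc i)

term : (ℕ → ℕ) → ℕ → ℕ → ℤ
term m zero     a = + layer m a
term m (suc k') a =
  (+ layer m a) ℤ.* prod1To k' (λ i → (+ layer m (a ∸ i)) ℤ.- (+ 1))
                ℤ.* (+ layer m (a ∸ suc k'))

Qcoeff : ℕ → (ℕ → ℕ) → ℕ → ℤ
Qcoeff n m zero = + 1
Qcoeff n m (suc k) with k ≤? n
... | yes _ = ℤ.- sumFromTo k n (λ a → sgn k ℤ.* term m k a)
... | no  _ = + 0

oneMinusT : ℕ → ℤ
oneMinusT zero          = + 1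
oneMinusT (suc zero)    = ℤ.- (+ 1)
oneMinusT (suc (suc _)) = + 0

seriesProd : (ℕ → ℕ) → (ℕ → ℤ) → ℕ → ℤ
seriesProd h q N = sumUpTo N (λ j → (+ h j) ℤ.* q (N ∸ j))

module Construction {c ℓ : Level} (F : Field c ℓ) (n : ℕ) (m : ℕ → ℕ) where
  open Field F using (Carrier; _≈_; 0#; 1#; _+_; _*_; -_)

  M : ℕ → ℕ
  M = layer m

  Vertex : Set
  Vertex = Σ ℕ (λ l → Fin (M l))

  Edge : Set
  Edge = Σ (Fin n) (λ i → Fin (M (suc (toℕ i))) × Fin (M (toℕ i)))

  tail : Edge → Vertex
  tail (i , v , w) = suc (toℕ i) , v

  head : Edge → Vertex
  head (i , v , w) = toℕ i , w

  _≟E_ : DecidableEquality Edge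
  (i , v , w) ≟E (j , v' , w') with i Fin.≟ j
  ... | no ¬p = no (λ eq → ¬p (cong proj₁ eq))
  ... | yes refl with v Fin.≟ v' | w Fin.≟ w'
  ...   | yes refl | yes refl = yes refl
  ...   | no ¬p    | _        = no (λ { refl → ¬p refl })
  ...   | yes _    | no ¬q    = no (λ { refl → ¬q refl })

  Word : Set
  Word = List Edge

  _≟W_ : DecidableEquality Word
  _≟W_ = ListP.≡-dec _≟E_

  -- elements of the free algebra T(E): finite formal sums of words
  Poly : Set c
  Poly = List (Carrier × Word)

  coeff : Poly → Word → Carrier
  coeff []            w = 0#
  coeff ((a , u) ∷ p) w with u ≟W w
  ... | yes _ = a + coeff p w
  ... | no  _ = coeff p w

  _≃_ : Poly → Poly → Set ℓ
  p ≃ q = ∀ w → coeff p w ≈ coeff q w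

  0P : Poly
  0P = []

  1P : Poly
  1P = (1# , []) ∷ []

  edgeP : Edge → Poly
  edgeP e = (1# , e ∷ []) ∷ []

  _+P_ : Poly → Poly → Poly
  p +P q = p ++ q

  scaleP : Carrier → Poly → Poly
  scaleP a = map (λ { (b , u) → (a * b , u) })

  -P_ : Poly → Poly
  -P p = map (λ { (b , u) → (- b , u) }) p

  _-P_ : Poly → Poly → Poly
  p -P q = p +P (-P q)

  _*P_ : Poly → Poly → Poly
  p *P q = concatMap (λ { (a , u) → map (λ { (b , v) → (a * b , u ++ v) }) q }) p

  sumP : List Poly → Poly
  sumP = foldl _+P_ 0P

  -- polynomials in a central variable τ with coefficients in T(E),
  -- as the list [c_0, …, c_m] representing Σ_j c_j τ^{m-j}.
  -- multiply on the right by (τ - e):  d_j = c_j - c_{j-1} e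
  stepτ : List Poly → Edge → List Poly
  stepτ cs e = zipWith _-P_ (cs ++ (0P ∷ [])) (0P ∷ map (λ x → x *P edgeP e) cs)

  -- coefficient list of P_π(τ) = (τ - e_1)⋯(τ - e_m)
  Pπ : List Edge → List Poly
  Pπ π = foldl stepτ (1P ∷ []) π

  nth : List Poly → ℕ → Poly
  nth []       _       = 0P
  nth (x ∷ _)  zero    = x
  nth (_ ∷ xs) (suc k) = nth xs k

  eπ : List Edge → ℕ → Poly
  eπ π j = nth (Pπ π) j

  data IsPath : List Edge → Set where
    nil  : IsPath []
    one  : ∀ e → IsPath (e ∷ [])
    cons : ∀ e e' es → head e ≡ tail e' → IsPath (e' ∷ es) → IsPath (e ∷ e' ∷ es)

  lastE : Edge → List Edge → Edge
  lastE e []        = e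
  lastE _ (e' ∷ es) = lastE e' es

  record Gen : Set where
    field
      e₁ e₂    : Edge
      r₁ r₂    : List Edge
      path₁    : IsPath (e₁ ∷ r₁)
      path₂    : IsPath (e₂ ∷ r₂)
      sameTail : tail e₁ ≡ tail e₂
      sameHead : head (lastE e₁ r₁) ≡ head (lastE e₂ r₂)
      k        : ℕ
      1≤k      : 1 ≤ k
      k≤len    : k ≤ length (e₁ ∷ r₁)

  genPoly : Gen → Poly
  genPoly g = eπ (e₁ ∷ r₁) k -P eπ (e₂ ∷ r₂) k
    where open Gen g

  InR : Poly → Set (c ⊔ ℓ)
  InR p = Σ (List (Poly × Gen × Poly))
            (λ L → p ≃ sumP (map (λ { (a , g , b) → (a *P genPoly g) *P b }) L))

  HomDeg : ℕ → Poly → Set c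
  HomDeg d p = All (λ x → length (proj₂ x) ≡ d) p

  lincomb : {r : ℕ} → (Fin r → Carrier) → (Fin r → Poly) → Poly
  lincomb {r} λs x = concatMap (λ j → scaleP (λs j) (x j)) (allFin r)

  -- dim_F A_d = r : there are x_1,…,x_r ∈ T(E)_d whose classes form a
  -- basis of A_d = image of T(E)_d in A(Γ) = T(E)/R.
  HasDim : ℕ → ℕ → Set (c ⊔ ℓ)
  HasDim d r =
    Σ (Fin r → Poly) λ x →
      (∀ j → HomDeg d (x j)) ×
      (∀ p → HomDeg d p → Σ (Fin r → Carrier) (λ λs → InR (p -P lincomb λs x))) ×
      (∀ (λs : Fin r → Carrier) → InR (lincomb λs x) → ∀ j → λs j ≈ 0#)

{-# OPTIONS --safe #-}

-- Choose a vertex * in every layer. For a vertex v of layer l let D v be the edge from v to the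
-- chosen vertex of layer l - 1; put e_l = D * and y_v = D v - D * for v ≠ *. The linear relations of
-- the diamonds v → w → u express every edge through these letters, and the quadratic ones become
--   y_v y_w = 0   and   e_{l+1} y_w = y_w (y_w + e_l)   (v, w in layers l + 1, l).
-- These rewriting rules are confluent, so the normal words, in which no letter of layer l + 1 precedes
-- a y_w of layer l, form a basis of A(Γ). They span because left multiplication of a normal word by a
-- letter needs at most one rewriting step. They are independent because the same one-step rule defines
-- an action of the letters on all words, in which every diamond, hence every relation, acts as zero.
--
-- Let G d l count the normal words of length d that do not start with a y of layer l. Then
--   h d = G d 0,   h (d+1) = Σ_{a≥1} m_a G d (a-1),   G (d+1) l = h (d+1) - (m_l - 1) G d (l-1),
-- and these recurrences determine the series.
module Submission where

open import Defs
open import Level using (Level; _⊔_)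
open import Algebra.Bundles using (Ring)
import Algebra.Properties.CommutativeSemigroup as CommutativeSemigroupProperties
import Algebra.Properties.Ring as RingProperties
import Algebra.Properties.Semiring.Sum as SemiringSum
open import Data.Bool as Bool using (Bool; true; false; if_then_else_)
open import Data.Empty using (⊥-elim)
open import Data.Fin as Fin using (Fin; toℕ; fromℕ<)
import Data.Fin.Properties as FinP
open import Data.Integer as ℤ using (ℤ; +_)
import Data.Integer.Properties as ℤP
open import Data.Integer.Tactic.RingSolver using (solve-∀)
open import Data.List using (List; []; _∷_; _++_; map; length; lookup; concat; concatMap; foldl; zipWith; allFin; tabulate; applyUpTo)
open import Data.List.Membership.Propositional using (_∈_)
import Data.List.Membership.Propositional.Properties as ∈P
import Data.List.Properties as ListP
open import Data.List.Relation.Unary.All as All using (All; []; _∷_)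
import Data.List.Relation.Unary.All.Properties as AllP
open import Data.List.Relation.Unary.AllPairs using ([]; _∷_)
open import Data.List.Relation.Unary.Any as Any using (here; there)
import Data.List.Relation.Unary.Any.Properties as AnyP
open import Data.List.Relation.Unary.Unique.Propositional using (Unique)
import Data.List.Relation.Unary.Unique.Propositional.Properties as UniqueP
open import Data.Nat as ℕ using (ℕ; zero; suc; _≤_; _<_; z≤n; s≤s; _∸_; _≤?_; _≡ᵇ_)
open import Data.Nat.ListAction using (sum)
open import Data.Nat.ListAction.Properties using (sum-++)
import Data.Nat.Properties as ℕP
open import Data.Product using (Σ; _×_; _,_; proj₁; proj₂)
import Data.Product.Properties as ProductP
open import Data.Sum using (inj₁; inj₂)
open import Function using (_∘_)
open import Relation.Binary.Definitions using (DecidableEquality)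
open import Relation.Binary.PropositionalEquality as ≡ using (_≡_; _≢_)
import Relation.Binary.Reasoning.Setoid as SetoidReasoning
open import Relation.Nullary using (Dec; yes; no; contradiction)

-- The power series identity

-- The quadratic rules come from diamonds that end in a chosen vertex. Comparing v → w → * with v →
-- * → * gives, for the edge d from v to w, d = D v - y_w and d D w = D v e_l, hence D v y_w = y_w D
-- w. The right side does not contain v: the case v = * is the rule for e_{l+1} y_w, and subtracting
-- it from the general case gives y_v y_w = 0. Confluence never appears as a statement about
-- rewriting. It enters as the fact that the operators satisfy the rules on every word, normal or
-- not. The overlaps e y y' and y y' y'' in three consecutive layers reduce to 0 in both ways. For
-- the series let G_l(t) = Σ_d G d l t^d and H = G_0. The recurrences read G_l = H - (m_l - 1) t
-- G_{l-1} and H = 1 + t Σ_a m_a G_{a-1}. For fixed a ≥ 1 the product of H with the sum over k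
-- collapses to m_a (1 - t) G_{a-1}; for a = 0 it is H.

sumUpTo-cong : ∀ N {f g : ℕ → ℤ} → (∀ j → j ≤ N → f j ≡ g j) → sumUpTo N f ≡ sumUpTo N g
sumUpTo-cong zero    f≗g = f≗g 0 z≤n
sumUpTo-cong (suc N) f≗g =
  ≡.cong₂ ℤ._+_ (sumUpTo-cong N (λ j j≤N → f≗g j (ℕP.m≤n⇒m≤1+n j≤N))) (f≗g (suc N) ℕP.≤-refl)

sumUpTo-+ : ∀ N (f g : ℕ → ℤ) → sumUpTo N (λ j → f j ℤ.+ g j) ≡ sumUpTo N f ℤ.+ sumUpTo N g
sumUpTo-+ zero    f g = ≡.refl
sumUpTo-+ (suc N) f g rewrite sumUpTo-+ N f g = lemma (sumUpTo N f) (sumUpTo N g) (f (suc N)) (g (suc N))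
  where
  lemma : ∀ a b c d → (a ℤ.+ b) ℤ.+ (c ℤ.+ d) ≡ (a ℤ.+ c) ℤ.+ (b ℤ.+ d)
  lemma = solve-∀

sumUpTo-* : ∀ N c (f : ℕ → ℤ) → sumUpTo N (λ j → c ℤ.* f j) ≡ c ℤ.* sumUpTo N f
sumUpTo-* zero    c f = ≡.refl
sumUpTo-* (suc N) c f rewrite sumUpTo-* N c f = ≡.sym (ℤP.*-distribˡ-+ c _ _)

sumUpTo-zero : ∀ N {f : ℕ → ℤ} → (∀ j → j ≤ N → f j ≡ + 0) → sumUpTo N f ≡ + 0
sumUpTo-zero zero    f≗0 = f≗0 0 z≤n
sumUpTo-zero (suc N) f≗0
  rewrite sumUpTo-zero N (λ j j≤N → f≗0 j (ℕP.m≤n⇒m≤1+n j≤N)) | f≗0 (suc N) ℕP.≤-refl = ≡.refl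

sumUpTo-front : ∀ N (f : ℕ → ℤ) → sumUpTo (suc N) f ≡ f 0 ℤ.+ sumUpTo N (f ∘ suc)
sumUpTo-front zero    f = ≡.refl
sumUpTo-front (suc N) f rewrite sumUpTo-front N f = ℤP.+-assoc (f 0) _ _

sumUpTo-drop : ∀ k N (f : ℕ → ℤ) → (∀ a → a < k → f a ≡ + 0) →
  sumUpTo (k ℕ.+ N) f ≡ sumUpTo N (λ i → f (k ℕ.+ i))
sumUpTo-drop zero    N f f≗0 = ≡.refl
sumUpTo-drop (suc k) N f f≗0
  rewrite sumUpTo-front (k ℕ.+ N) f | f≗0 0 (s≤s z≤n)
        | sumUpTo-drop k N (f ∘ suc) (λ a a<k → f≗0 (suc a) (s≤s a<k)) = ℤP.+-identityˡ _

sumUpTo-comm : ∀ N K (f : ℕ → ℕ → ℤ) →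
  sumUpTo N (λ j → sumUpTo K (f j)) ≡ sumUpTo K (λ a → sumUpTo N (λ j → f j a))
sumUpTo-comm zero    K f = ≡.refl
sumUpTo-comm (suc N) K f rewrite sumUpTo-comm N K f =
  ≡.sym (sumUpTo-+ K (λ a → sumUpTo N (λ j → f j a)) (f (suc N)))

-- Bridge between the inclusive integer sums over layers 0 to `N` and the list sums of naturals
-- produced by counting, where index `j` stands for layer `suc j`; layer 0 is split off.
sumUpTo-applyUpTo : ∀ N (f : ℕ → ℤ) (g : ℕ → ℕ) → (∀ j → j < N → f (suc j) ≡ + g j) →
  sumUpTo N f ≡ f 0 ℤ.+ + sum (applyUpTo g N)
sumUpTo-applyUpTo zero    f g f≗g = ≡.sym (ℤP.+-identityʳ _)
sumUpTo-applyUpTo (suc N) f g f≗g = begin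
  sumUpTo (suc N) f                                       ≡⟨ sumUpTo-front N f ⟩
  f 0 ℤ.+ sumUpTo N (f ∘ suc)                             ≡⟨ ≡.cong (λ z → f 0 ℤ.+ z) (sumUpTo-applyUpTo N (f ∘ suc) (g ∘ suc) λ j j<N → f≗g (suc j) (s≤s j<N)) ⟩
  f 0 ℤ.+ (f 1 ℤ.+ + sum (applyUpTo (g ∘ suc) N))         ≡⟨ ≡.cong (λ z → f 0 ℤ.+ (z ℤ.+ _)) (f≗g 0 (s≤s z≤n)) ⟩
  f 0 ℤ.+ (+ g 0 ℤ.+ + sum (applyUpTo (g ∘ suc) N))       ∎
  where open ≡.≡-Reasoning

prod1To-front : ∀ K (f : ℕ → ℤ) → prod1To (suc K) f ≡ f 1 ℤ.* prod1To K (f ∘ suc)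
prod1To-front zero    f = ℤP.*-comm (+ 1) (f 1)
prod1To-front (suc K) f rewrite prod1To-front K f = ℤP.*-assoc (f 1) _ _

seriesProd-suc : ∀ h q N → seriesProd h q (suc N) ≡ seriesProd h (q ∘ suc) N ℤ.+ (+ h (suc N)) ℤ.* q 0
seriesProd-suc h q N = ≡.cong₂ ℤ._+_
  (sumUpTo-cong N (λ j j≤N → ≡.cong (λ i → + h j ℤ.* q i) (ℕP.+-∸-assoc 1 j≤N)))
  (≡.cong (λ i → + h (suc N) ℤ.* q i) (ℕP.n∸n≡0 N))

seriesProd-cong : ∀ h {q r} N → (∀ k → q k ≡ r k) → seriesProd h q N ≡ seriesProd h r N
seriesProd-cong h N q≗r = sumUpTo-cong N (λ j _ → ≡.cong (+ h j ℤ.*_) (q≗r (N ∸ j)))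

seriesProd-* : ∀ h c q N → seriesProd h (λ k → c ℤ.* q k) N ≡ c ℤ.* seriesProd h q N
seriesProd-* h c q N =
  ≡.trans (sumUpTo-cong N (λ j _ → lemma (+ h j) c (q (N ∸ j)))) (sumUpTo-* N c _)
  where
  lemma : ∀ a b c → a ℤ.* (b ℤ.* c) ≡ b ℤ.* (a ℤ.* c)
  lemma = solve-∀

seriesProd-zero : ∀ h N → seriesProd h (λ _ → + 0) N ≡ + 0
seriesProd-zero h N = sumUpTo-zero N (λ j _ → ℤP.*-zeroʳ (+ h j))

seriesProd-sumUpTo : ∀ h K (q : ℕ → ℕ → ℤ) N →
  seriesProd h (λ k → sumUpTo K (q k)) N ≡ sumUpTo K (λ a → seriesProd h (λ k → q k a) N)
seriesProd-sumUpTo h K q N =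
  ≡.trans (sumUpTo-cong N (λ j _ → ≡.sym (sumUpTo-* K (+ h j) (q (N ∸ j))))) (sumUpTo-comm N K _)

module Series (n : ℕ) (m : ℕ → ℕ) where

  M : ℕ → ℤ
  M a = + layer m a

  -- T k a is (-1)^k times the term of index k, a, extended by 0 to k > a, and V k a is the same
  -- product with its leading factor m_a replaced by m_a - 1 (for k ≥ 1); so V satisfies a recurrence.
  V : ℕ → ℕ → ℤ
  V zero    a       = M a
  V (suc k) zero    = + 0
  V (suc k) (suc a) = ℤ.- (M (suc a) ℤ.- + 1) ℤ.* V k a

  T : ℕ → ℕ → ℤ
  T zero    a       = M a
  T (suc k) zero    = + 0
  T (suc k) (suc a) = ℤ.- M (suc a) ℤ.* V k a

  V-zero : ∀ k a → a < k → V k a ≡ + 0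
  V-zero (suc k) zero    a<k       = ≡.refl
  V-zero (suc k) (suc a) (s≤s a<k) rewrite V-zero k a a<k = ℤP.*-zeroʳ (ℤ.- (M (suc a) ℤ.- + 1))

  T-zero : ∀ k a → a < k → T k a ≡ + 0
  T-zero (suc k) zero    a<k       = ≡.refl
  T-zero (suc k) (suc a) (s≤s a<k) rewrite V-zero k a a<k = ℤP.*-zeroʳ (ℤ.- M (suc a))

  V-prod : ∀ k i → V k (k ℕ.+ i) ≡
    sgn k ℤ.* (prod1To k (λ j → M (suc (k ℕ.+ i) ∸ j) ℤ.- + 1) ℤ.* M i)
  V-prod zero    i = ≡.sym (≡.trans (ℤP.*-identityˡ _) (ℤP.*-identityˡ _))
  V-prod (suc k) i
    rewrite V-prod k i
          | prod1To-front k (λ j → M (suc (suc k ℕ.+ i) ∸ j) ℤ.- + 1) =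
    lemma (M (suc (k ℕ.+ i)) ℤ.- + 1) (sgn k) _ (M i)
    where
    lemma : ∀ c s p x → ℤ.- c ℤ.* (s ℤ.* (p ℤ.* x)) ≡ ℤ.- s ℤ.* ((c ℤ.* p) ℤ.* x)
    lemma = solve-∀

  T-term : ∀ k i → T k (k ℕ.+ i) ≡ sgn k ℤ.* term m k (k ℕ.+ i)
  T-term zero    i = ≡.sym (ℤP.*-identityˡ _)
  T-term (suc k) i
    rewrite V-prod k i | ℕP.m+n∸m≡n k i = lemma (M (suc (k ℕ.+ i))) (sgn k) _ (M i)
    where
    lemma : ∀ c s p x → ℤ.- c ℤ.* (s ℤ.* (p ℤ.* x)) ≡ ℤ.- s ℤ.* ((c ℤ.* p) ℤ.* x)
    lemma = solve-∀

  -- Since `T k a` vanishes for `a < k`, the inner sum may start at 0, and for `k > n` it is 0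
  -- altogether. The range of `a` thus no longer depends on `k`, and the two sums can be exchanged.
  Qcoeff-suc : ∀ k → Qcoeff n m (suc k) ≡ ℤ.- (+ 1) ℤ.* sumUpTo n (T k)
  Qcoeff-suc k with k ≤? n
  ... | yes k≤n = ≡.trans (≡.cong ℤ.-_ eq) (≡.sym (ℤP.-1*i≡-i _))
    where
    eq : sumFromTo k n (λ a → sgn k ℤ.* term m k a) ≡ sumUpTo n (T k)
    eq = ≡.sym (≡.trans
      (≡.trans (≡.cong (λ z → sumUpTo z (T k)) (≡.sym (ℕP.m+[n∸m]≡n k≤n)))
             (sumUpTo-drop k (n ∸ k) (T k) (T-zero k)))
      (sumUpTo-cong (n ∸ k) (λ i _ → T-term k i)))
  ... | no k≰n rewrite sumUpTo-zero n {T k} (λ a a≤n → T-zero k a (ℕP.≤-<-trans a≤n (ℕP.≰⇒> k≰n))) = ≡.refl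

  -- The counts enter only through these three recurrences. The last is stated without subtraction
  -- because it lives in ℕ; `g-step` gives the subtractive form in ℤ.
  module _ (G : ℕ → ℕ → ℕ)
    (G-zero : ∀ l → G 0 l ≡ 1)
    (G-sum  : ∀ d → G (suc d) 0 ≡ sum (applyUpTo (λ l → layer m (suc l) ℕ.* G d l) n))
    (G-step : ∀ d l → l < n →
      G (suc d) (suc l) ℕ.+ layer m (suc l) ℕ.* G d l ≡ G (suc d) 0 ℕ.+ G d l)
    where

    h : ℕ → ℕ
    h d = G d 0

    g : ℕ → ℕ → ℤ
    g d l = + G d l

    g-step : ∀ d l → l < n → g (suc d) (suc l) ≡ g (suc d) 0 ℤ.- (M (suc l) ℤ.- + 1) ℤ.* g d l
    g-step d l l<n = begin
      x                                    ≡⟨ lemma₁ x y z ⟩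
      (x ℤ.+ y ℤ.* z) ℤ.- y ℤ.* z          ≡⟨ ≡.cong (λ t → t ℤ.- y ℤ.* z) eq ⟩
      (w ℤ.+ z) ℤ.- y ℤ.* z                ≡⟨ lemma₂ w y z ⟩
      w ℤ.- (y ℤ.- + 1) ℤ.* z              ∎
      where
      open ≡.≡-Reasoning
      x = g (suc d) (suc l)
      y = M (suc l)
      z = g d l
      w = g (suc d) 0
      eq : x ℤ.+ y ℤ.* z ≡ w ℤ.+ z
      eq = ≡.trans (≡.cong (λ t → x ℤ.+ t) (≡.sym (ℤP.pos-* (layer m (suc l)) (G d l)))) (≡.cong +_ (G-step d l l<n))
      lemma₁ : ∀ x y z → x ≡ (x ℤ.+ y ℤ.* z) ℤ.- y ℤ.* z
      lemma₁ = solve-∀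
      lemma₂ : ∀ w y z → (w ℤ.+ z) ℤ.- y ℤ.* z ≡ w ℤ.- (y ℤ.- + 1) ℤ.* z
      lemma₂ = solve-∀

    -- Coefficients of the products of the Hilbert series with Σ_k V k b t^k and Σ_k T k a t^k.
    W : ℕ → ℕ → ℤ
    W N b = seriesProd h (λ k → V k b) N

    S : ℕ → ℕ → ℤ
    S N a = seriesProd h (λ k → T k a) N

    W-zero : ∀ N → W N 0 ≡ g N 0
    W-zero zero    = ℤP.*-identityʳ _
    W-zero (suc N) = begin
      W (suc N) 0                                          ≡⟨ seriesProd-suc h (λ k → V k 0) N ⟩
      seriesProd h (λ _ → + 0) N ℤ.+ g (suc N) 0 ℤ.* + 1   ≡⟨ ≡.cong₂ ℤ._+_ (seriesProd-zero h N) (ℤP.*-identityʳ (g (suc N) 0)) ⟩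
      + 0 ℤ.+ g (suc N) 0                                  ≡⟨ ℤP.+-identityˡ _ ⟩
      g (suc N) 0                                          ∎
      where open ≡.≡-Reasoning

    W-suc : ∀ N b → W (suc N) (suc b) ≡
      ℤ.- (M (suc b) ℤ.- + 1) ℤ.* W N b ℤ.+ g (suc N) 0 ℤ.* M (suc b)
    W-suc N b = ≡.trans (seriesProd-suc h (λ k → V k (suc b)) N)
      (≡.cong (λ w → w ℤ.+ g (suc N) 0 ℤ.* M (suc b)) (seriesProd-* h (ℤ.- (M (suc b) ℤ.- + 1)) (λ k → V k b) N))

    -- In generating functions W_{b+1} = m_{b+1} H - (m_{b+1} - 1) t W_b, whereas G_{b+1} = H -
    -- (m_{b+1} - 1) t G_b. Inserting the claim for W_b on the left and the recurrences for G_{b+1}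
    -- and G_b on the right gives the same expression; the start is W_0 = H.
    W-closed : ∀ N b → suc b ≤ n → W N (suc b) ≡ g N (suc b) ℤ.+ (M (suc b) ℤ.- + 1) ℤ.* g N b
    W-closed zero b b<n rewrite G-zero 0 | G-zero b | G-zero (suc b) = lemma (M (suc b))
      where
      lemma : ∀ x → + 1 ℤ.* x ≡ + 1 ℤ.+ (x ℤ.- + 1) ℤ.* + 1
      lemma = solve-∀
    W-closed (suc N) zero b<n = begin
      W (suc N) 1                                               ≡⟨ W-suc N 0 ⟩
      ℤ.- (x ℤ.- + 1) ℤ.* W N 0 ℤ.+ c ℤ.* x                     ≡⟨ ≡.cong (λ w → ℤ.- (x ℤ.- + 1) ℤ.* w ℤ.+ c ℤ.* x) (W-zero N) ⟩
      ℤ.- (x ℤ.- + 1) ℤ.* a ℤ.+ c ℤ.* x                         ≡⟨ lemma x a c ⟩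
      (c ℤ.- (x ℤ.- + 1) ℤ.* a) ℤ.+ (x ℤ.- + 1) ℤ.* c           ≡⟨ ≡.cong (λ w → w ℤ.+ (x ℤ.- + 1) ℤ.* c) (g-step N 0 b<n) ⟨
      g (suc N) 1 ℤ.+ (x ℤ.- + 1) ℤ.* c                         ∎
      where
      open ≡.≡-Reasoning
      x = M 1
      a = g N 0
      c = g (suc N) 0
      lemma : ∀ x a c → ℤ.- (x ℤ.- + 1) ℤ.* a ℤ.+ c ℤ.* x ≡
        (c ℤ.- (x ℤ.- + 1) ℤ.* a) ℤ.+ (x ℤ.- + 1) ℤ.* c
      lemma = solve-∀
    W-closed (suc N) (suc b) b<n = begin
      W (suc N) (suc (suc b))                                   ≡⟨ W-suc N (suc b) ⟩
      ℤ.- (x ℤ.- + 1) ℤ.* W N (suc b) ℤ.+ c ℤ.* x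
        ≡⟨ ≡.cong (λ w → ℤ.- (x ℤ.- + 1) ℤ.* w ℤ.+ c ℤ.* x) (W-closed N b (ℕP.<⇒≤ b<n)) ⟩
      ℤ.- (x ℤ.- + 1) ℤ.* (a ℤ.+ (y ℤ.- + 1) ℤ.* a′) ℤ.+ c ℤ.* x ≡⟨ lemma x y a a′ c ⟩
      (c ℤ.- (x ℤ.- + 1) ℤ.* a) ℤ.+ (x ℤ.- + 1) ℤ.* (c ℤ.- (y ℤ.- + 1) ℤ.* a′)
        ≡⟨ ≡.cong₂ (λ v w → v ℤ.+ (x ℤ.- + 1) ℤ.* w) (g-step N (suc b) b<n) (g-step N b (ℕP.<⇒≤ b<n)) ⟨
      g (suc N) (suc (suc b)) ℤ.+ (x ℤ.- + 1) ℤ.* g (suc N) (suc b) ∎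
      where
      open ≡.≡-Reasoning
      x = M (suc (suc b))
      y = M (suc b)
      a = g N (suc b)
      a′ = g N b
      c = g (suc N) 0
      lemma : ∀ x y a b c →
        ℤ.- (x ℤ.- + 1) ℤ.* (a ℤ.+ (y ℤ.- + 1) ℤ.* b) ℤ.+ c ℤ.* x ≡
        (c ℤ.- (x ℤ.- + 1) ℤ.* a) ℤ.+ (x ℤ.- + 1) ℤ.* (c ℤ.- (y ℤ.- + 1) ℤ.* b)
      lemma = solve-∀

    -- This is the coefficient of t^{N+1} in H - t W_a = (1 - t) G_a: by `W-closed` t W_a = t G_a +
    -- (m_a - 1) t G_{a-1}, and the last term is H - G_a.
    complement : ∀ N a → a ≤ n → g (suc N) 0 ℤ.- W N a ≡ g (suc N) a ℤ.- g N a
    complement N zero    _   = ≡.cong (λ z → g (suc N) 0 ℤ.- z) (W-zero N)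
    complement N (suc a) a≤n = begin
      c ℤ.- W N (suc a)                   ≡⟨ ≡.cong (λ w → c ℤ.- w) (W-closed N a a≤n) ⟩
      c ℤ.- (g N (suc a) ℤ.+ y)           ≡⟨ lemma c (g N (suc a)) y ⟩
      (c ℤ.- y) ℤ.- g N (suc a)           ≡⟨ ≡.cong (λ w → w ℤ.- g N (suc a)) (g-step N a a≤n) ⟨
      g (suc N) (suc a) ℤ.- g N (suc a)   ∎
      where
      open ≡.≡-Reasoning
      c = g (suc N) 0
      y = (M (suc a) ℤ.- + 1) ℤ.* g N a
      lemma : ∀ c x y → c ℤ.- (x ℤ.+ y) ≡ (c ℤ.- y) ℤ.- x
      lemma = solve-∀

    S-suc : ∀ N a → a ≤ n → S (suc N) (suc a) ≡ M (suc a) ℤ.* g (suc N) a ℤ.- M (suc a) ℤ.* g N a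
    S-suc N a a≤n = begin
      S (suc N) (suc a)                                            ≡⟨ seriesProd-suc h (λ k → T k (suc a)) N ⟩
      seriesProd h (λ k → ℤ.- x ℤ.* V k a) N ℤ.+ g (suc N) 0 ℤ.* x ≡⟨ ≡.cong (λ w → w ℤ.+ g (suc N) 0 ℤ.* x) (seriesProd-* h (ℤ.- x) (λ k → V k a) N) ⟩
      ℤ.- x ℤ.* W N a ℤ.+ g (suc N) 0 ℤ.* x                        ≡⟨ lemma₁ x (W N a) (g (suc N) 0) ⟩
      x ℤ.* (g (suc N) 0 ℤ.- W N a)                                ≡⟨ ≡.cong (x ℤ.*_) (complement N a a≤n) ⟩
      x ℤ.* (g (suc N) a ℤ.- g N a)                                ≡⟨ lemma₂ x (g (suc N) a) (g N a) ⟩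
      x ℤ.* g (suc N) a ℤ.- x ℤ.* g N a                            ∎
      where
      open ≡.≡-Reasoning
      x = M (suc a)
      lemma₁ : ∀ x w c → ℤ.- x ℤ.* w ℤ.+ c ℤ.* x ≡ x ℤ.* (c ℤ.- w)
      lemma₁ = solve-∀
      lemma₂ : ∀ x a b → x ℤ.* (a ℤ.- b) ≡ x ℤ.* a ℤ.- x ℤ.* b
      lemma₂ = solve-∀

    S-zero : ∀ N → S N 0 ≡ g N 0
    S-zero zero    = ℤP.*-identityʳ _
    S-zero (suc N) = ≡.trans (seriesProd-suc h (λ k → T k 0) N)
      (≡.trans (≡.cong₂ ℤ._+_ (seriesProd-zero h N) (ℤP.*-identityʳ (g (suc N) 0))) (ℤP.+-identityˡ _))

    f : ℕ → ℕ → ℤ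
    f d zero    = + 0
    f d (suc l) = M (suc l) ℤ.* g d l

    g-sum : ∀ d → sumUpTo n (f d) ≡ g (suc d) 0
    g-sum d = ≡.trans
      (sumUpTo-applyUpTo n _ (λ l → layer m (suc l) ℕ.* G d l) (λ l _ → ≡.sym (ℤP.pos-* (layer m (suc l)) (G d l))))
      (≡.trans (ℤP.+-identityˡ _) (≡.cong +_ (≡.sym (G-sum d))))

    -- The layers a ≥ 1 contribute (1 - t) Σ m_a G_{a-1} = (1 - t)(H - 1) / t and layer 0
    -- contributes H. In positive degree the total has the coefficients of H shifted by one.
    S-sum-suc : ∀ N → sumUpTo n (S (suc N)) ≡ g (suc (suc N)) 0
    S-sum-suc N = begin
      sumUpTo n (S (suc N))                                              ≡⟨ sumUpTo-cong n split ⟩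
      sumUpTo n (λ a → (c a ℤ.+ f (suc N) a) ℤ.+ -1ℤ ℤ.* f N a)          ≡⟨ sumUpTo-+ n _ _ ⟩
      sumUpTo n (λ a → c a ℤ.+ f (suc N) a) ℤ.+ sumUpTo n (λ a → -1ℤ ℤ.* f N a)
        ≡⟨ ≡.cong₂ ℤ._+_ (sumUpTo-+ n c (f (suc N))) (sumUpTo-* n -1ℤ (f N)) ⟩
      (sumUpTo n c ℤ.+ sumUpTo n (f (suc N))) ℤ.+ -1ℤ ℤ.* sumUpTo n (f N)
        ≡⟨ ≡.cong₂ (λ x y → x ℤ.+ -1ℤ ℤ.* y) (≡.cong₂ ℤ._+_ c-sum (g-sum (suc N))) (g-sum N) ⟩
      (g (suc N) 0 ℤ.+ g (suc (suc N)) 0) ℤ.+ -1ℤ ℤ.* g (suc N) 0        ≡⟨ lemma (g (suc N) 0) _ ⟩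
      g (suc (suc N)) 0                                                  ∎
      where
      open ≡.≡-Reasoning
      -1ℤ = ℤ.- (+ 1)
      -- The contribution of layer 0, supported at `a = 0`, so that `split` has one shape for all
      -- `a`.
      c : ℕ → ℤ
      c zero    = g (suc N) 0
      c (suc _) = + 0
      c-sum : sumUpTo n c ≡ g (suc N) 0
      c-sum = ≡.trans (sumUpTo-applyUpTo n c (λ _ → 0) (λ _ _ → ≡.refl)) (≡.trans (≡.cong (λ z → c 0 ℤ.+ + z) (zeros n)) (ℤP.+-identityʳ _))
        where
        zeros : ∀ k → sum (applyUpTo (λ _ → 0) k) ≡ 0
        zeros zero    = ≡.refl
        zeros (suc k) = zeros k
      lemma₁ : ∀ x → x ≡ (x ℤ.+ + 0) ℤ.+ ℤ.- (+ 1) ℤ.* + 0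
      lemma₁ = solve-∀
      lemma₂ : ∀ x y → x ℤ.- y ≡ (+ 0 ℤ.+ x) ℤ.+ ℤ.- (+ 1) ℤ.* y
      lemma₂ = solve-∀
      split : ∀ a → a ≤ n → S (suc N) a ≡ (c a ℤ.+ f (suc N) a) ℤ.+ -1ℤ ℤ.* f N a
      split zero    _   = ≡.trans (S-zero (suc N)) (lemma₁ _)
      split (suc a) a≤n = ≡.trans (S-suc N a (ℕP.<⇒≤ a≤n)) (lemma₂ (M (suc a) ℤ.* g (suc N) a) (M (suc a) ℤ.* g N a))
      lemma : ∀ x y → (x ℤ.+ y) ℤ.+ ℤ.- (+ 1) ℤ.* x ≡ y
      lemma = solve-∀

    S-sum-zero : sumUpTo n (S 0) ≡ + 1 ℤ.+ g 1 0
    S-sum-zero = ≡.trans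
      (sumUpTo-applyUpTo n (S 0) (λ l → layer m (suc l) ℕ.* G 0 l) eq)
      (≡.cong₂ ℤ._+_ (≡.trans (S-zero 0) (≡.cong +_ (G-zero 0))) (≡.cong +_ (≡.sym (G-sum 0))))
      where
      eq : ∀ l → l < n → S 0 (suc l) ≡ + (layer m (suc l) ℕ.* G 0 l)
      eq l _ rewrite G-zero 0 | G-zero l = ≡.trans (ℤP.*-identityˡ _) (≡.cong +_ (≡.sym (ℕP.*-identityʳ _)))

    seriesProd-Qcoeff : ∀ N → seriesProd h (Qcoeff n m) N ≡ oneMinusT N
    seriesProd-Qcoeff zero    = ≡.trans (ℤP.*-identityʳ _) (≡.cong +_ (G-zero 0))
    seriesProd-Qcoeff (suc N) = begin
      seriesProd h (Qcoeff n m) (suc N)                                ≡⟨ seriesProd-suc h (Qcoeff n m) N ⟩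
      seriesProd h (Qcoeff n m ∘ suc) N ℤ.+ g (suc N) 0 ℤ.* + 1        ≡⟨ ≡.cong₂ ℤ._+_ expand (ℤP.*-identityʳ (g (suc N) 0)) ⟩
      ℤ.- (+ 1) ℤ.* sumUpTo n (S N) ℤ.+ g (suc N) 0                    ≡⟨ final N ⟩
      oneMinusT (suc N)                                                ∎
      where
      open ≡.≡-Reasoning
      expand : seriesProd h (Qcoeff n m ∘ suc) N ≡ ℤ.- (+ 1) ℤ.* sumUpTo n (S N)
      expand = ≡.trans (seriesProd-cong h N Qcoeff-suc)
        (≡.trans (seriesProd-* h (ℤ.- (+ 1)) (λ k → sumUpTo n (T k)) N)
               (≡.cong (ℤ.- (+ 1) ℤ.*_) (seriesProd-sumUpTo h n T N)))
      lemma₀ : ∀ x → ℤ.- (+ 1) ℤ.* (+ 1 ℤ.+ x) ℤ.+ x ≡ ℤ.- (+ 1)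
      lemma₀ = solve-∀
      lemma₁ : ∀ x → ℤ.- (+ 1) ℤ.* x ℤ.+ x ≡ + 0
      lemma₁ = solve-∀
      final : ∀ N → ℤ.- (+ 1) ℤ.* sumUpTo n (S N) ℤ.+ g (suc N) 0 ≡ oneMinusT (suc N)
      final zero    rewrite S-sum-zero  = lemma₀ (g 1 0)
      final (suc N) rewrite S-sum-suc N = lemma₁ (g (suc (suc N)) 0)

-- Normal words

module _ {a b} {A : Set a} {B : A → Set b} where

  attach : ∀ x → B x → Σ A B
  attach x y = x , y

  listΣ : List A → (∀ x → List (B x)) → List (Σ A B)
  listΣ []       f = []
  listΣ (x ∷ xs) f = map (attach x) (f x) ++ listΣ xs f

  ∈-listΣ⁺ : ∀ {x y xs f} → x ∈ xs → y ∈ f x → (x , y) ∈ listΣ xs f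
  ∈-listΣ⁺ (here ≡.refl) y∈ = ∈P.∈-++⁺ˡ (∈P.∈-map⁺ (attach _) y∈)
  ∈-listΣ⁺ {f = f} (there {x = x} x∈) y∈ = ∈P.∈-++⁺ʳ (map (attach x) (f x)) (∈-listΣ⁺ x∈ y∈)

  ∈-listΣ⁻ : ∀ {x y} xs {f} → (x , y) ∈ listΣ xs f → x ∈ xs × y ∈ f x
  ∈-listΣ⁻ (x ∷ xs) {f} xy∈ with ∈P.∈-++⁻ (map (attach x) (f x)) xy∈
  ... | inj₁ p with ∈P.∈-map⁻ (attach x) p
  ...   | _ , y∈ , ≡.refl = here ≡.refl , y∈
  ∈-listΣ⁻ (x ∷ xs) xy∈ | inj₂ p with ∈-listΣ⁻ xs p
  ...   | x∈ , y∈ = there x∈ , y∈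

  listΣ⁺ : ∀ {xs f} → Unique xs → (∀ x → Unique (f x)) → Unique (listΣ xs f)
  listΣ⁺ {[]}     []        uf = []
  listΣ⁺ {x ∷ xs} (x∉ ∷ ux) uf =
    UniqueP.++⁺ (UniqueP.map⁺ (λ { ≡.refl → ≡.refl }) (uf x)) (listΣ⁺ ux uf) disjoint
    where
    disjoint : ∀ {p} → p ∈ map (attach x) _ × p ∈ listΣ xs _ → _
    disjoint (p∈ , q∈) with ∈P.∈-map⁻ (attach x) p∈
    ... | _ , _ , ≡.refl = All.lookup x∉ (proj₁ (∈-listΣ⁻ xs q∈)) ≡.refl

  length-listΣ : ∀ xs f → length (listΣ xs f) ≡ sum (map (λ x → length (f x)) xs)
  length-listΣ []       f = ≡.refl
  length-listΣ (x ∷ xs) f = ≡.trans (ListP.length-++ (map (attach x) (f x)))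
    (≡.cong₂ ℕ._+_ (ListP.length-map (attach x) (f x)) (length-listΣ xs f))

  sum-listΣ : ∀ xs f (g : A → ℕ) →
    sum (map (λ p → g (proj₁ p)) (listΣ xs f)) ≡ sum (map (λ x → length (f x) ℕ.* g x) xs)
  sum-listΣ []       f g = ≡.refl
  sum-listΣ (x ∷ xs) f g = begin
    sum (map (g ∘ proj₁) (map (attach x) (f x) ++ listΣ xs f))
      ≡⟨ ≡.cong sum (ListP.map-++ (g ∘ proj₁) (map (attach x) (f x)) _) ⟩
    sum (map (g ∘ proj₁) (map (attach x) (f x)) ++ map (g ∘ proj₁) (listΣ xs f))
      ≡⟨ sum-++ (map (g ∘ proj₁) (map (attach x) (f x))) _ ⟩
    sum (map (g ∘ proj₁) (map (attach x) (f x))) ℕ.+ sum (map (g ∘ proj₁) (listΣ xs f))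
      ≡⟨ ≡.cong₂ ℕ._+_ (constant (f x)) (sum-listΣ xs f g) ⟩
    length (f x) ℕ.* g x ℕ.+ sum (map (λ x → length (f x) ℕ.* g x) xs) ∎
    where
    open ≡.≡-Reasoning
    constant : ∀ ys → sum (map (g ∘ proj₁) (map (attach x) ys)) ≡ length ys ℕ.* g x
    constant []       = ≡.refl
    constant (y ∷ ys) = ≡.cong (g x ℕ.+_) (constant ys)

Unique⇒lookup-injective : ∀ {a} {A : Set a} {xs : List A} → Unique xs →
  ∀ {i j} → lookup xs i ≡ lookup xs j → i ≡ j
Unique⇒lookup-injective {xs = x ∷ xs} (x∉ ∷ u) {Fin.zero}  {Fin.zero}  eq = ≡.refl
Unique⇒lookup-injective {xs = x ∷ xs} (x∉ ∷ u) {Fin.zero}  {Fin.suc j} eq =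
  ⊥-elim (All.lookup x∉ (∈P.∈-lookup j) eq)
Unique⇒lookup-injective {xs = x ∷ xs} (x∉ ∷ u) {Fin.suc i} {Fin.zero}  eq =
  ⊥-elim (All.lookup x∉ (∈P.∈-lookup i) (≡.sym eq))
Unique⇒lookup-injective {xs = x ∷ xs} (x∉ ∷ u) {Fin.suc i} {Fin.suc j} eq =
  ≡.cong Fin.suc (Unique⇒lookup-injective u eq)

sum-allFin : ∀ n (f : ℕ → ℕ) → sum (map (λ i → f (toℕ i)) (allFin n)) ≡ sum (applyUpTo f n)
sum-allFin n f = ≡.cong sum (≡.trans (ListP.map-tabulate {n = n} (λ i → i) (λ i → f (toℕ i))) (tabulate-toℕ n f))
  where
  tabulate-toℕ : ∀ n (f : ℕ → ℕ) → tabulate {n = n} (λ i → f (toℕ i)) ≡ applyUpTo f n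
  tabulate-toℕ zero    f = ≡.refl
  tabulate-toℕ (suc n) f = ≡.cong (f 0 ∷_) (tabulate-toℕ n (f ∘ suc))

sum-cong : ∀ n (f g : ℕ → ℕ) → (∀ j → f j ≡ g j) → sum (applyUpTo f n) ≡ sum (applyUpTo g n)
sum-cong zero    f g eq = ≡.refl
sum-cong (suc n) f g eq = ≡.cong₂ ℕ._+_ (eq 0) (sum-cong n (f ∘ suc) (g ∘ suc) (eq ∘ suc))

-- Each side adds the entry that the other sum has at `l`, the only index where the sequences may
-- differ; no truncated subtraction arises.
sum-exchange : ∀ n l (f g : ℕ → ℕ) → l < n → (∀ j → j ≢ l → f j ≡ g j) →
  sum (applyUpTo f n) ℕ.+ g l ≡ sum (applyUpTo g n) ℕ.+ f l
sum-exchange (suc n) zero f g _ eq = begin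
  (f 0 ℕ.+ F) ℕ.+ g 0 ≡⟨ ℕP.+-comm (f 0 ℕ.+ F) (g 0) ⟩
  g 0 ℕ.+ (f 0 ℕ.+ F) ≡⟨ ≡.cong (g 0 ℕ.+_) (ℕP.+-comm (f 0) F) ⟩
  g 0 ℕ.+ (F ℕ.+ f 0) ≡⟨ ℕP.+-assoc (g 0) F (f 0) ⟨
  (g 0 ℕ.+ F) ℕ.+ f 0 ≡⟨ ≡.cong (λ z → (g 0 ℕ.+ z) ℕ.+ f 0) (sum-cong n (f ∘ suc) (g ∘ suc) (λ j → eq (suc j) λ ())) ⟩
  (g 0 ℕ.+ sum (applyUpTo (g ∘ suc) n)) ℕ.+ f 0 ∎
  where
  open ≡.≡-Reasoning
  F = sum (applyUpTo (f ∘ suc) n)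
sum-exchange (suc n) (suc l) f g (s≤s l<n) eq = begin
  (f 0 ℕ.+ sum (applyUpTo (f ∘ suc) n)) ℕ.+ g (suc l) ≡⟨ ℕP.+-assoc (f 0) _ _ ⟩
  f 0 ℕ.+ (sum (applyUpTo (f ∘ suc) n) ℕ.+ g (suc l))
    ≡⟨ ≡.cong₂ ℕ._+_ (eq 0 λ ()) (sum-exchange n l (f ∘ suc) (g ∘ suc) l<n (λ j j≢l → eq (suc j) (j≢l ∘ ℕP.suc-injective))) ⟩
  g 0 ℕ.+ (sum (applyUpTo (g ∘ suc) n) ℕ.+ f (suc l)) ≡⟨ ℕP.+-assoc (g 0) _ _ ⟨
  (g 0 ℕ.+ sum (applyUpTo (g ∘ suc) n)) ℕ.+ f (suc l) ∎
  where open ≡.≡-Reasoning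

module NormalWords (n : ℕ) (m : ℕ → ℕ) (pos : ∀ i → 1 ≤ i → i ≤ n → 1 ≤ m i) where

  Letter : Set
  Letter = Σ (Fin n) (λ i → Fin (layer m (suc (toℕ i))))

  star : ∀ i → Fin (layer m (suc (toℕ i)))
  star i = fromℕ< (pos (suc (toℕ i)) (s≤s z≤n) (FinP.toℕ<n i))

  toℕ-star : ∀ i → toℕ (star i) ≡ 0
  toℕ-star i = FinP.toℕ-fromℕ< (pos (suc (toℕ i)) (s≤s z≤n) (FinP.toℕ<n i))

  -- The letter `(i , v)` lies in layer `suc (toℕ i)` and number 0 is the chosen vertex, so exactly
  -- the y of layer `l` are excluded. No letter has layer 0, hence index 0 excludes nothing.
  Allowed : ℕ → Letter → Set
  Allowed l (i , v) = suc (toℕ i) ≡ l → toℕ v ≡ 0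

  -- Normal l u: u is a normal word and remains one after a letter of layer l is put in front.
  data Normal : ℕ → List Letter → Set where
    []  : ∀ {l} → Normal l []
    _∷_ : ∀ {l a u} → Allowed l a → Normal (toℕ (proj₁ a)) u → Normal l (a ∷ u)

  choices : ℕ → (i : Fin n) → List (Fin (layer m (suc (toℕ i))))
  choices l i with suc (toℕ i) ℕ.≟ l
  ... | yes _ = star i ∷ []
  ... | no  _ = allFin _

  allowed : ℕ → List Letter
  allowed l = listΣ (allFin n) (choices l)

  normalWords : ℕ → ℕ → List (List Letter)
  normalWords zero    l = [] ∷ []
  normalWords (suc d) l =
    map (λ au → proj₁ au ∷ proj₂ au) (listΣ (allowed l) (λ a → normalWords d (toℕ (proj₁ a))))

  ∈-allowed⁺ : ∀ {l} a → Allowed l a → a ∈ allowed l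
  ∈-allowed⁺ {l} (i , v) ok = ∈-listΣ⁺ (∈P.∈-allFin i) lemma
    where
    lemma : v ∈ choices l i
    lemma with suc (toℕ i) ℕ.≟ l
    ... | yes p = here (FinP.toℕ-injective (≡.trans (ok p) (≡.sym (toℕ-star i))))
    ... | no  _ = ∈P.∈-allFin v

  ∈-allowed⁻ : ∀ {l a} → a ∈ allowed l → Allowed l a
  ∈-allowed⁻ {l} {i , v} a∈ p with suc (toℕ i) ℕ.≟ l | proj₂ (∈-listΣ⁻ (allFin n) {choices l} a∈)
  ... | yes _ | here ≡.refl = toℕ-star i
  ... | no ¬p | _         = contradiction p ¬p

  ∈-normalWords⁺ : ∀ {l u} → Normal l u → u ∈ normalWords (length u) l
  ∈-normalWords⁺ []       = here ≡.refl
  ∈-normalWords⁺ (_∷_ {a = a} ok nf) =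
    ∈P.∈-map⁺ _ (∈-listΣ⁺ (∈-allowed⁺ a ok) (∈-normalWords⁺ nf))

  ∈-normalWords⁻ : ∀ d {l u} → u ∈ normalWords d l → Normal l u × length u ≡ d
  ∈-normalWords⁻ zero    (here ≡.refl) = [] , ≡.refl
  ∈-normalWords⁻ (suc d) {l} u∈ with ∈P.∈-map⁻ _ u∈
  ... | (a , u) , p∈ , ≡.refl with ∈-listΣ⁻ (allowed l) p∈
  ...   | a∈ , u∈′ with ∈-normalWords⁻ d u∈′
  ...     | nf , len = (∈-allowed⁻ a∈ ∷ nf) , ≡.cong suc len

  normalWords⁺ : ∀ d l → Unique (normalWords d l)
  normalWords⁺ zero    l = [] ∷ []
  normalWords⁺ (suc d) l = UniqueP.map⁺ (λ { ≡.refl → ≡.refl })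
    (listΣ⁺ (listΣ⁺ (UniqueP.allFin⁺ n) choices⁺) (λ a → normalWords⁺ d (toℕ (proj₁ a))))
    where
    choices⁺ : ∀ i → Unique (choices l i)
    choices⁺ i with suc (toℕ i) ℕ.≟ l
    ... | yes _ = [] ∷ []
    ... | no  _ = UniqueP.allFin⁺ _

  weight : ℕ → ℕ → ℕ
  weight l j with suc j ℕ.≟ l
  ... | yes _ = 1
  ... | no  _ = layer m (suc j)

  length-choices : ∀ l i → length (choices l i) ≡ weight l (toℕ i)
  length-choices l i with suc (toℕ i) ℕ.≟ l
  ... | yes _ = ≡.refl
  ... | no  _ = ListP.length-tabulate _

  weight-≡ : ∀ j → weight (suc j) j ≡ 1
  weight-≡ j with suc j ℕ.≟ suc j
  ... | yes _ = ≡.refl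
  ... | no ¬p = contradiction ≡.refl ¬p

  weight-≢ : ∀ l j → suc j ≢ l → weight l j ≡ layer m (suc j)
  weight-≢ l j ne with suc j ℕ.≟ l
  ... | yes p = contradiction p ne
  ... | no  _ = ≡.refl

  count : ℕ → ℕ → ℕ
  count d l = length (normalWords d l)

  count-suc : ∀ d l → count (suc d) l ≡ sum (applyUpTo (λ j → weight l j ℕ.* count d j) n)
  count-suc d l = begin
    count (suc d) l
      ≡⟨ ListP.length-map _ (listΣ (allowed l) _) ⟩
    length (listΣ (allowed l) (λ a → normalWords d (toℕ (proj₁ a))))
      ≡⟨ length-listΣ (allowed l) _ ⟩
    sum (map (λ a → count d (toℕ (proj₁ a))) (allowed l))
      ≡⟨ sum-listΣ (allFin n) (choices l) (λ i → count d (toℕ i)) ⟩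
    sum (map (λ i → length (choices l i) ℕ.* count d (toℕ i)) (allFin n))
      ≡⟨ ≡.cong sum (ListP.map-cong (λ i → ≡.cong (ℕ._* _) (length-choices l i)) (allFin n)) ⟩
    sum (map (λ i → weight l (toℕ i) ℕ.* count d (toℕ i)) (allFin n))
      ≡⟨ sum-allFin n (λ j → weight l j ℕ.* count d j) ⟩
    sum (applyUpTo (λ j → weight l j ℕ.* count d j) n) ∎
    where open ≡.≡-Reasoning

  count-sum : ∀ d → count (suc d) 0 ≡ sum (applyUpTo (λ l → layer m (suc l) ℕ.* count d l) n)
  count-sum d = ≡.trans (count-suc d 0)
    (sum-cong n _ _ (λ j → ≡.cong (ℕ._* count d j) (weight-≢ 0 j λ ())))

  -- Passing from index 0 to `suc l` affects only first letters of layer `suc l`: of its m_{l+1}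
  -- letters just e_{l+1} survives, so one summand drops from `layer m (suc l) ℕ.* count d l` to
  -- `count d l`.
  count-step : ∀ d l → l < n →
    count (suc d) (suc l) ℕ.+ layer m (suc l) ℕ.* count d l ≡ count (suc d) 0 ℕ.+ count d l
  count-step d l l<n = begin
    count (suc d) (suc l) ℕ.+ layer m (suc l) ℕ.* count d l
      ≡⟨ ≡.cong (ℕ._+ (layer m (suc l) ℕ.* count d l)) (count-suc d (suc l)) ⟩
    sum (applyUpTo (λ j → weight (suc l) j ℕ.* count d j) n) ℕ.+ layer m (suc l) ℕ.* count d l
      ≡⟨ sum-exchange n l _ (λ j → layer m (suc j) ℕ.* count d j) l<n
           (λ j j≢l → ≡.cong (ℕ._* count d j) (weight-≢ (suc l) j (j≢l ∘ ℕP.suc-injective))) ⟩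
    sum (applyUpTo (λ j → layer m (suc j) ℕ.* count d j) n) ℕ.+ weight (suc l) l ℕ.* count d l
      ≡⟨ ≡.cong₂ ℕ._+_ (≡.sym (count-sum d)) (≡.trans (≡.cong (ℕ._* count d l) (weight-≡ l)) (ℕP.*-identityˡ _)) ⟩
    count (suc d) 0 ℕ.+ count d l ∎
    where open ≡.≡-Reasoning

-- The algebra A(Γ) as a quotient ring

module QuotientRing {a b i} (T : Ring a b) (I : Ring.Carrier T → Set i) where
  open Ring T
  open RingProperties T
  open CommutativeSemigroupProperties +-commutativeSemigroup using (interchange)
  open SetoidReasoning setoid

  infix 4 _~_
  record _~_ (x y : Carrier) : Set i where
    constructor mk~
    field difference : I (x - y)
  open _~_

  module _
    (resp : ∀ {x y} → x ≈ y → I x → I y)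
    (I-0# : I 0#)
    (I-+  : ∀ {x y} → I x → I y → I (x + y))
    (I-*ˡ : ∀ x {y} → I y → I (x * y))
    (I-*ʳ : ∀ x {y} → I y → I (y * x))
    where

    private
      I-neg : ∀ {x} → I x → I (- x)
      I-neg {x} p = resp (-1*x≈-x x) (I-*ˡ (- 1#) p)

      telescope : ∀ x y z → (x - y) + (y - z) ≈ x - z
      telescope x y z = begin
        (x - y) + (y - z)     ≈⟨ +-assoc x (- y) (y - z) ⟩
        x + (- y + (y - z))   ≈⟨ +-congˡ (+-assoc (- y) y (- z)) ⟨
        x + (- y + y - z)     ≈⟨ +-congˡ (+-congʳ (-‿inverseˡ y)) ⟩
        x + (0# - z)          ≈⟨ +-congˡ (+-identityˡ (- z)) ⟩
        x - z                 ∎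

    ≈⇒~ : ∀ {x y} → x ≈ y → x ~ y
    ≈⇒~ x≈y = mk~ (resp (sym (x≈y⇒x∙y⁻¹≈ε x≈y)) I-0#)

    ~-sym : ∀ {x y} → x ~ y → y ~ x
    ~-sym {x} {y} (mk~ p) = mk~ (resp (⁻¹-anti-homo‿- x y) (I-neg p))

    ~-trans : ∀ {x y z} → x ~ y → y ~ z → x ~ z
    ~-trans (mk~ p) (mk~ q) = mk~ (resp (telescope _ _ _) (I-+ p q))

    +-cong~ : ∀ {x x′ y y′} → x ~ x′ → y ~ y′ → x + y ~ x′ + y′
    +-cong~ {x} {x′} {y} {y′} (mk~ p) (mk~ q) = mk~
      (resp (trans (interchange x (- x′) y (- y′)) (+-congˡ (-‿+-comm x′ y′))) (I-+ p q))

    neg-cong~ : ∀ {x y} → x ~ y → - x ~ - y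
    neg-cong~ {x} {y} (mk~ p) = mk~ (resp (sym (-‿+-comm x (- y))) (I-neg p))

    *-cong~ : ∀ {x x′ y y′} → x ~ x′ → y ~ y′ → x * y ~ x′ * y′
    *-cong~ {x} {x′} {y} {y′} (mk~ p) (mk~ q) = mk~ (resp eq (I-+ (I-*ʳ y p) (I-*ˡ x′ q)))
      where
      eq : (x - x′) * y + x′ * (y - y′) ≈ x * y - x′ * y′
      eq = begin
        (x - x′) * y + x′ * (y - y′)                  ≈⟨ +-cong ([y-z]x≈yx-zx y x x′) (x[y-z]≈xy-xz x′ y y′) ⟩
        (x * y - x′ * y) + (x′ * y - x′ * y′)         ≈⟨ telescope _ _ _ ⟩
        x * y - x′ * y′                               ∎

    quotientRing : Ring a i
    quotientRing = record
      { Carrier = Carrier ; _≈_ = _~_ ; _+_ = _+_ ; _*_ = _*_ ; -_ = -_ ; 0# = 0# ; 1# = 1#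
      ; isRing = record
        { +-isAbelianGroup = record
          { isGroup = record
            { isMonoid = record
              { isSemigroup = record
                { isMagma = record
                  { isEquivalence = record { refl = ≈⇒~ refl ; sym = ~-sym ; trans = ~-trans }
                  ; ∙-cong = +-cong~ }
                ; assoc = λ x y z → ≈⇒~ (+-assoc x y z) }
              ; identity = (λ x → ≈⇒~ (+-identityˡ x)) , (λ x → ≈⇒~ (+-identityʳ x)) }
            ; inverse = (λ x → ≈⇒~ (-‿inverseˡ x)) , (λ x → ≈⇒~ (-‿inverseʳ x))
            ; ⁻¹-cong = neg-cong~ }
          ; comm = λ x y → ≈⇒~ (+-comm x y) }
        ; *-cong = *-cong~
        ; *-assoc = λ x y z → ≈⇒~ (*-assoc x y z)
        ; *-identity = (λ x → ≈⇒~ (*-identityˡ x)) , (λ x → ≈⇒~ (*-identityʳ x))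
        ; distrib = (λ x y z → ≈⇒~ (distribˡ x y z)) , (λ x y z → ≈⇒~ (distribʳ x y z)) } }

-- Formal sums and the free algebra

module Pairing {c ℓ} (F : Field c ℓ) where
  open Field F hiding (zero)
  open RingProperties ring
  open CommutativeSemigroupProperties +-commutativeSemigroup using (interchange)
  open CommutativeSemigroupProperties *-commutativeSemigroup using (x∙yz≈y∙xz)
  open SetoidReasoning setoid

  -- The linear extension of `f` to formal sums. Identities between formal sums are proved by
  -- evaluating both sides against every `f`.
  pair : ∀ {x} {X : Set x} → (X → Carrier) → List (Carrier × X) → Carrier
  pair f []            = 0#
  pair f ((a , u) ∷ p) = a * f u + pair f p

  module _ {x} {X : Set x} where

    pair-cong : ∀ {f g : X → Carrier} → (∀ u → f u ≈ g u) → ∀ p → pair f p ≈ pair g p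
    pair-cong f≗g []            = refl
    pair-cong f≗g ((a , u) ∷ p) = +-cong (*-congˡ (f≗g u)) (pair-cong f≗g p)

    pair-++ : ∀ (f : X → Carrier) p q → pair f (p ++ q) ≈ pair f p + pair f q
    pair-++ f []            q = sym (+-identityˡ _)
    pair-++ f ((a , u) ∷ p) q = trans (+-congˡ (pair-++ f p q)) (sym (+-assoc _ _ _))

    pair-+ : ∀ (f g : X → Carrier) p → pair (λ u → f u + g u) p ≈ pair f p + pair g p
    pair-+ f g []            = sym (+-identityˡ _)
    pair-+ f g ((a , u) ∷ p) =
      trans (+-cong (distribˡ a (f u) (g u)) (pair-+ f g p)) (interchange _ _ _ _)

    pair-* : ∀ b (f : X → Carrier) p → pair (λ u → b * f u) p ≈ b * pair f p
    pair-* b f []            = sym (zeroʳ b)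
    pair-* b f ((a , u) ∷ p) = begin
      a * (b * f u) + pair (λ u → b * f u) p ≈⟨ +-cong (x∙yz≈y∙xz a b (f u)) (pair-* b f p) ⟩
      b * (a * f u) + b * pair f p           ≈⟨ distribˡ b _ _ ⟨
      b * (a * f u + pair f p)               ∎

    pair-0 : ∀ (p : List (Carrier × X)) → pair (λ _ → 0#) p ≈ 0#
    pair-0 []            = refl
    pair-0 ((a , u) ∷ p) = trans (+-cong (zeroʳ a) (pair-0 p)) (+-identityˡ _)

    pair-singleton : ∀ (f : X → Carrier) u → pair f ((1# , u) ∷ []) ≈ f u
    pair-singleton f u = trans (+-identityʳ _) (*-identityˡ _)

  pair-comm : ∀ {x y} {X : Set x} {Y : Set y} (f : X → Y → Carrier) p q →
    pair (λ u → pair (f u) q) p ≈ pair (λ v → pair (λ u → f u v) p) q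
  pair-comm f []            q = sym (pair-0 q)
  pair-comm f ((a , u) ∷ p) q = begin
    a * pair (f u) q + pair (λ u → pair (f u) q) p               ≈⟨ +-cong (sym (pair-* a (f u) q)) (pair-comm f p q) ⟩
    pair (λ v → a * f u v) q + pair (λ v → pair (λ u → f u v) p) q ≈⟨ pair-+ _ _ q ⟨
    pair (λ v → a * f u v + pair (λ u → f u v) p) q              ∎

  pair-map : ∀ {x y} {X : Set x} {Y : Set y} a (k : X → Y) {g} → (∀ b v → g (b , v) ≡ (a * b , k v)) →
    ∀ f q → pair f (map g q) ≈ a * pair (λ v → f (k v)) q
  pair-map a k eq f []            = sym (zeroʳ a)
  pair-map a k eq f ((b , v) ∷ q) rewrite eq b v = begin
    a * b * f (k v) + pair f (map _ q)               ≈⟨ +-cong (*-assoc a b _) (pair-map a k eq f q) ⟩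
    a * (b * f (k v)) + a * pair (λ v → f (k v)) q   ≈⟨ distribˡ a _ _ ⟨
    a * (b * f (k v) + pair (λ v → f (k v)) q)       ∎

module FreeAlgebra {c ℓ} (F : Field c ℓ) (n : ℕ) (m : ℕ → ℕ) where
  open Field F hiding (zero)
  open Construction F n m
  open RingProperties ring
  open Pairing F
  open CommutativeSemigroupProperties +-commutativeSemigroup using (x∙yz≈y∙xz)
  open SetoidReasoning setoid

  pair-scaleP : ∀ f a p → pair f (scaleP a p) ≈ a * pair f p
  pair-scaleP f a p = pair-map a (λ u → u) (λ _ _ → ≡.refl) f p

  pair-neg : ∀ f p → pair f (-P p) ≈ - pair f p
  pair-neg f []            = sym -0#≈0#
  pair-neg f ((a , u) ∷ p) =
    trans (+-cong (sym (-‿distribˡ-* a (f u))) (pair-neg f p)) (-‿+-comm _ _)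

  pair-minus : ∀ f p q → pair f (p -P q) ≈ pair f p - pair f q
  pair-minus f p q = trans (pair-++ f p (-P q)) (+-congˡ (pair-neg f q))

  pair-*P : ∀ f p q → pair f (p *P q) ≈ pair (λ u → pair (λ v → f (u ++ v)) q) p
  pair-*P f []            q = refl
  pair-*P f ((a , u) ∷ p) q = trans (pair-++ f (map _ q) (p *P q))
    (+-cong (pair-map a (u ++_) (λ _ _ → ≡.refl) f q) (pair-*P f p q))

  δ : Word → Word → Carrier
  δ w u with u ≟W w
  ... | yes _ = 1#
  ... | no  _ = 0#

  coeff-pair : ∀ p w → coeff p w ≈ pair (δ w) p
  coeff-pair []            w = refl
  coeff-pair ((a , u) ∷ p) w with u ≟W w
  ... | yes _ = +-cong (sym (*-identityʳ a)) (coeff-pair p w)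
  ... | no  _ = trans (coeff-pair p w) (sym (trans (+-congʳ (zeroʳ a)) (+-identityˡ _)))

  remove : Word → Poly → Poly
  remove w [] = []
  remove w ((a , u) ∷ p) with u ≟W w
  ... | yes _ = remove w p
  ... | no  _ = (a , u) ∷ remove w p

  pair-remove : ∀ f w p → pair f p ≈ coeff p w * f w + pair f (remove w p)
  pair-remove f w [] = sym (trans (+-identityʳ _) (zeroˡ _))
  pair-remove f w ((a , u) ∷ p) with u ≟W w
  ... | yes ≡.refl = begin
    a * f u + pair f p                                    ≈⟨ +-congˡ (pair-remove f w p) ⟩
    a * f u + (coeff p w * f u + pair f (remove w p))     ≈⟨ +-assoc _ _ _ ⟨
    a * f u + coeff p w * f u + pair f (remove w p)       ≈⟨ +-congʳ (distribʳ (f u) a _) ⟨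
    (a + coeff p w) * f u + pair f (remove w p)           ∎
  ... | no _ = trans (+-congˡ (pair-remove f w p)) (x∙yz≈y∙xz _ _ _)

  coeff-remove-≡ : ∀ w p → coeff (remove w p) w ≈ 0#
  coeff-remove-≡ w [] = refl
  coeff-remove-≡ w ((a , u) ∷ p) with u ≟W w
  ... | yes _ = coeff-remove-≡ w p
  ... | no ¬p with u ≟W w
  ...   | yes q = contradiction q ¬p
  ...   | no  _ = coeff-remove-≡ w p

  coeff-remove-≢ : ∀ w v p → v ≢ w → coeff (remove w p) v ≈ coeff p v
  coeff-remove-≢ w v []            v≢w = refl
  coeff-remove-≢ w v ((a , u) ∷ p) v≢w with u ≟W w
  coeff-remove-≢ w v ((a , u) ∷ p) v≢w | yes u≡w with u ≟W v
  ... | yes u≡v = contradiction (≡.trans (≡.sym u≡v) u≡w) v≢w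
  ... | no  _   = coeff-remove-≢ w v p v≢w
  coeff-remove-≢ w v ((a , u) ∷ p) v≢w | no _ with u ≟W v
  ... | yes _ = +-congˡ (coeff-remove-≢ w v p v≢w)
  ... | no  _ = coeff-remove-≢ w v p v≢w

  length-remove : ∀ w p → length (remove w p) ≤ length p
  length-remove w [] = z≤n
  length-remove w ((a , u) ∷ p) with u ≟W w
  ... | yes _ = ℕP.m≤n⇒m≤1+n (length-remove w p)
  ... | no  _ = s≤s (length-remove w p)

  remove-head : ∀ a u p → remove u ((a , u) ∷ p) ≡ remove u p
  remove-head a u p with u ≟W u
  ... | yes _ = ≡.refl
  ... | no ¬p = contradiction ≡.refl ¬p

  -- Induction on the number of terms: coeff p u = 0 lets all occurrences of u be removed at once.
  pair-zero : ∀ k p → length p ≤ k → (∀ w → coeff p w ≈ 0#) → ∀ f → pair f p ≈ 0#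
  pair-zero k       []            _        p≃0 f = refl
  pair-zero (suc k) (x@(a , u) ∷ p) (s≤s len) p≃0 f = begin
    pair f (x ∷ p)                                                 ≈⟨ pair-remove f u (x ∷ p) ⟩
    coeff (x ∷ p) u * f u + pair f (remove u (x ∷ p))              ≈⟨ +-cong (trans (*-congʳ (p≃0 u)) (zeroˡ _)) rest ⟩
    0# + 0#                                                        ≈⟨ +-identityˡ 0# ⟩
    0#                                                             ∎
    where
    vanish : ∀ w → coeff (remove u (x ∷ p)) w ≈ 0#
    vanish w with w ≟W u
    ... | yes ≡.refl = coeff-remove-≡ u (x ∷ p)
    ... | no  w≢u    = trans (coeff-remove-≢ u w (x ∷ p) w≢u) (p≃0 w)
    rest : pair f (remove u (x ∷ p)) ≈ 0#
    rest = pair-zero k (remove u (x ∷ p))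
      (≡.subst (λ q → length q ≤ k) (≡.sym (remove-head a u p)) (ℕP.≤-trans (length-remove u p) len))
      vanish f

  infix 4 _≐_
  -- The functions `δ w` recover coefficientwise equality. With every `f` allowed, congruence of
  -- `_*P_` needs no sum over the factorisations of a word, because `pair-*P` evaluates a product as
  -- an iterated pairing.
  record _≐_ (p q : Poly) : Set (c ⊔ ℓ) where
    constructor mk≐
    field at : ∀ (f : Word → Carrier) → pair f p ≈ pair f q
  open _≐_ public

  ≃⇒≐ : ∀ {p q} → p ≃ q → p ≐ q
  ≃⇒≐ {p} {q} p≃q .at f = x∙y⁻¹≈ε⇒x≈y _ _
    (trans (sym (pair-minus f p q)) (pair-zero _ (p -P q) ℕP.≤-refl vanish f))
    where
    vanish : ∀ w → coeff (p -P q) w ≈ 0#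
    vanish w = begin
      coeff (p -P q) w                ≈⟨ coeff-pair (p -P q) w ⟩
      pair (δ w) (p -P q)             ≈⟨ pair-minus (δ w) p q ⟩
      pair (δ w) p - pair (δ w) q     ≈⟨ +-cong (coeff-pair p w) (-‿cong (coeff-pair q w)) ⟨
      coeff p w - coeff q w           ≈⟨ x≈y⇒x∙y⁻¹≈ε (p≃q w) ⟩
      0#                              ∎

  ≐⇒≃ : ∀ {p q} → p ≐ q → p ≃ q
  ≐⇒≃ {p} {q} p≐q w = trans (coeff-pair p w) (trans (at p≐q (δ w)) (sym (coeff-pair q w)))

  *P-cong : ∀ {p p′ q q′} → p ≐ p′ → q ≐ q′ → p *P q ≐ p′ *P q′
  *P-cong {p} {p′} {q} {q′} p≐ q≐ .at f = begin
    pair f (p *P q)                                ≈⟨ pair-*P f p q ⟩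
    pair (λ u → pair (λ v → f (u ++ v)) q) p       ≈⟨ pair-cong (λ u → at q≐ (λ v → f (u ++ v))) p ⟩
    pair (λ u → pair (λ v → f (u ++ v)) q′) p      ≈⟨ at p≐ _ ⟩
    pair (λ u → pair (λ v → f (u ++ v)) q′) p′     ≈⟨ pair-*P f p′ q′ ⟨
    pair f (p′ *P q′)                              ∎

  *P-assoc : ∀ p q r → (p *P q) *P r ≐ p *P (q *P r)
  *P-assoc p q r .at f = begin
    pair f ((p *P q) *P r)                                                     ≈⟨ pair-*P f (p *P q) r ⟩
    pair (λ u → pair (λ w → f (u ++ w)) r) (p *P q)                            ≈⟨ pair-*P _ p q ⟩
    pair (λ u → pair (λ v → pair (λ w → f ((u ++ v) ++ w)) r) q) p
      ≈⟨ pair-cong (λ u → pair-cong (λ v → pair-cong (λ w → reflexive (≡.cong f (ListP.++-assoc u v w))) r) q) p ⟩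
    pair (λ u → pair (λ v → pair (λ w → f (u ++ (v ++ w))) r) q) p             ≈⟨ pair-cong (λ u → pair-*P (λ x → f (u ++ x)) q r) p ⟨
    pair (λ u → pair (λ x → f (u ++ x)) (q *P r)) p                            ≈⟨ pair-*P f p (q *P r) ⟨
    pair f (p *P (q *P r))                                                     ∎

  *P-distribˡ : ∀ p q r → p *P (q +P r) ≐ (p *P q) +P (p *P r)
  *P-distribˡ p q r .at f = begin
    pair f (p *P (q +P r))                                      ≈⟨ pair-*P f p (q +P r) ⟩
    pair (λ u → pair (λ v → f (u ++ v)) (q ++ r)) p             ≈⟨ pair-cong (λ u → pair-++ _ q r) p ⟩
    pair (λ u → pair (λ v → f (u ++ v)) q + pair (λ v → f (u ++ v)) r) p ≈⟨ pair-+ _ _ p ⟩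
    pair (λ u → pair (λ v → f (u ++ v)) q) p + pair (λ u → pair (λ v → f (u ++ v)) r) p
      ≈⟨ +-cong (pair-*P f p q) (pair-*P f p r) ⟨
    pair f (p *P q) + pair f (p *P r)                           ≈⟨ pair-++ f (p *P q) (p *P r) ⟨
    pair f ((p *P q) +P (p *P r))                               ∎

  *P-distribʳ : ∀ r p q → (p +P q) *P r ≐ (p *P r) +P (q *P r)
  *P-distribʳ r p q .at f = reflexive (≡.cong (pair f) (ListP.concatMap-++ _ p q))

  *P-identityˡ : ∀ p → 1P *P p ≐ p
  *P-identityˡ p .at f = trans (pair-*P f 1P p) (pair-singleton (λ u → pair (λ v → f (u ++ v)) p) [])

  *P-identityʳ : ∀ p → p *P 1P ≐ p
  *P-identityʳ p .at f = trans (pair-*P f p 1P)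
    (pair-cong (λ u → trans (pair-singleton (λ v → f (u ++ v)) []) (reflexive (≡.cong f (ListP.++-identityʳ u)))) p)

  +P-comm : ∀ p q → p +P q ≐ q +P p
  +P-comm p q .at f = trans (pair-++ f p q) (trans (+-comm _ _) (sym (pair-++ f q p)))

  -P-inverseʳ : ∀ p → p +P (-P p) ≐ 0P
  -P-inverseʳ p .at f = trans (pair-minus f p p) (-‿inverseʳ _)

  ≡⇒≐ : ∀ {p q} → p ≡ q → p ≐ q
  ≡⇒≐ p≡q .at f = reflexive (≡.cong (pair f) p≡q)

  polyRing : Ring c (c ⊔ ℓ)
  polyRing = record
    { Carrier = Poly ; _≈_ = _≐_ ; _+_ = _+P_ ; _*_ = _*P_ ; -_ = -P_ ; 0# = 0P ; 1# = 1P
    ; isRing = record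
      { +-isAbelianGroup = record
        { isGroup = record
          { isMonoid = record
            { isSemigroup = record
              { isMagma = record
                { isEquivalence = record
                  { refl = mk≐ λ f → refl
                  ; sym = λ p → mk≐ λ f → sym (at p f)
                  ; trans = λ p q → mk≐ λ f → trans (at p f) (at q f) }
                ; ∙-cong = λ {p} {p′} {q} {q′} p≐ q≐ → mk≐ λ f →
                    trans (pair-++ f p q) (trans (+-cong (at p≐ f) (at q≐ f)) (sym (pair-++ f p′ q′))) }
              ; assoc = λ p q r → ≡⇒≐ (ListP.++-assoc p q r) }
            ; identity = (λ p → ≡⇒≐ ≡.refl) , (λ p → ≡⇒≐ (ListP.++-identityʳ p)) }
          ; inverse = (λ p → mk≐ λ f → trans (at (+P-comm (-P p) p) f) (at (-P-inverseʳ p) f)) , -P-inverseʳ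
          ; ⁻¹-cong = λ {p} {q} p≐q → mk≐ λ f →
              trans (pair-neg f p) (trans (-‿cong (at p≐q f)) (sym (pair-neg f q))) }
        ; comm = +P-comm }
      ; *-cong = *P-cong
      ; *-assoc = *P-assoc
      ; *-identity = *P-identityˡ , *P-identityʳ
      ; distrib = *P-distribˡ , *P-distribʳ } }

  private module P = Ring polyRing

  relator : Poly × Gen × Poly → Poly
  relator (a , g , b) = (a *P genPoly g) *P b

  combination : List (Poly × Gen × Poly) → Poly
  combination L = concat (map relator L)

  -- `InR` with `_≐_` in place of `_≃_` and `concat` in place of the left fold `sumP`, so that
  -- closure under sums and products can be checked term by term.
  record Ideal (p : Poly) : Set (c ⊔ ℓ) where
    constructor mkIdeal
    field
      multipliers : List (Poly × Gen × Poly)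
      expansion   : p ≐ combination multipliers

  sumP-concat : ∀ ps → sumP ps ≡ concat ps
  sumP-concat = go []
    where
    go : ∀ acc ps → foldl _+P_ acc ps ≡ acc ++ concat ps
    go acc []       = ≡.sym (ListP.++-identityʳ acc)
    go acc (p ∷ ps) = ≡.trans (go (acc +P p) ps) (ListP.++-assoc acc p (concat ps))

  Ideal⇒InR : ∀ {p} → Ideal p → InR p
  Ideal⇒InR {p} (mkIdeal L p≐) =
    L , ≡.subst (p ≃_) (≡.sym (sumP-concat (map relator L))) (≐⇒≃ p≐)

  InR⇒Ideal : ∀ {p} → InR p → Ideal p
  InR⇒Ideal {p} (L , p≃) = mkIdeal L (≃⇒≐ (≡.subst (p ≃_) (sumP-concat (map relator L)) p≃))

  Ideal-resp : ∀ {p q} → p ≐ q → Ideal p → Ideal q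
  Ideal-resp p≐q (mkIdeal L p≐) = mkIdeal L (P.trans (P.sym p≐q) p≐)

  Ideal-0 : Ideal 0P
  Ideal-0 = mkIdeal [] P.refl

  combination-++ : ∀ K L → combination (K ++ L) ≐ combination K +P combination L
  combination-++ K L = ≡⇒≐ (ListP.concatMap-++ relator K L)

  Ideal-+ : ∀ {p q} → Ideal p → Ideal q → Ideal (p +P q)
  Ideal-+ (mkIdeal K p≐) (mkIdeal L q≐) =
    mkIdeal (K ++ L) (P.trans (P.+-cong p≐ q≐) (P.sym (combination-++ K L)))

  Ideal-*ˡ : ∀ a {p} → Ideal p → Ideal (a *P p)
  Ideal-*ˡ a (mkIdeal L p≐) = mkIdeal (map step L) (P.trans (*P-cong (P.refl {a}) p≐) (go L))
    where
    step : Poly × Gen × Poly → Poly × Gen × Poly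
    step (x , g , y) = a *P x , g , y
    go : ∀ L → a *P combination L ≐ combination (map step L)
    go []                  = P.zeroʳ a
    go (t@(x , g , y) ∷ L) = P.trans (P.distribˡ a (relator t) (combination L))
      (P.+-cong
        (P.trans (P.sym (P.*-assoc a (x *P genPoly g) y))
                 (*P-cong (P.sym (P.*-assoc a x (genPoly g))) P.refl))
        (go L))

  Ideal-*ʳ : ∀ b {p} → Ideal p → Ideal (p *P b)
  Ideal-*ʳ b (mkIdeal L p≐) = mkIdeal (map step L) (P.trans (*P-cong p≐ P.refl) (go L))
    where
    step : Poly × Gen × Poly → Poly × Gen × Poly
    step (x , g , y) = x , g , y *P b
    go : ∀ L → combination L *P b ≐ combination (map step L)
    go []                  = P.refl
    go (t@(x , g , y) ∷ L) = P.trans (P.distribʳ b (relator t) (combination L))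
      (P.+-cong (P.*-assoc (x *P genPoly g) y b) (go L))

  Ideal-gen : ∀ g → Ideal (genPoly g)
  Ideal-gen g = mkIdeal ((1P , g , 1P) ∷ []) (P.sym
    (P.trans (P.+-identityʳ _) (P.trans (P.*-identityʳ _) (P.*-identityˡ _))))

  module Q = QuotientRing polyRing Ideal
  open Q public using (_~_; mk~)

  A : Ring c (c ⊔ ℓ)
  A = Q.quotientRing Ideal-resp Ideal-0 Ideal-+ Ideal-*ˡ Ideal-*ʳ

  ≐⇒~ : ∀ {p q} → p ≐ q → p ~ q
  ≐⇒~ = Q.≈⇒~ Ideal-resp Ideal-0 Ideal-+ Ideal-*ˡ Ideal-*ʳ

-- The action on words

-- A pair (l , 0) stands for the letter e_l, and (l , suc k) for a letter y of layer l.
-- blocked l b: a letter of layer l may not precede b in a normal word.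
blocked : ℕ → ℕ × ℕ → Bool
blocked l (l′ , zero)  = false
blocked l (l′ , suc _) = l ≡ᵇ suc l′

≡ᵇ-refl : ∀ l → (l ≡ᵇ l) ≡ true
≡ᵇ-refl zero    = ≡.refl
≡ᵇ-refl (suc l) = ≡ᵇ-refl l

≡ᵇ-suc : ∀ l → (l ≡ᵇ suc l) ≡ false
≡ᵇ-suc zero    = ≡.refl
≡ᵇ-suc (suc l) = ≡ᵇ-suc l

module Representation {c ℓ} (F : Field c ℓ) (n : ℕ) (m : ℕ → ℕ) where
  open Field F hiding (zero)
  open Construction F n m
  open RingProperties ring
  open CommutativeSemigroupProperties +-commutativeSemigroup using (interchange)
  open Pairing F
  open FreeAlgebra F n m
  open SetoidReasoning setoid

  Functional : Set c
  Functional = List (ℕ × ℕ) → Carrier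

  record Linear (T : Functional → Functional) : Set (c ⊔ ℓ) where
    field
      congruent   : ∀ {f g} → (∀ x → f x ≈ g x) → ∀ x → T f x ≈ T g x
      additive    : ∀ f g x → T (λ y → f y + g y) x ≈ T f x + T g x
      homogeneous : ∀ a f x → T (λ y → a * f y) x ≈ a * T f x

    zero-preserving : ∀ x → T (λ _ → 0#) x ≈ 0#
    zero-preserving x = begin
      T (λ _ → 0#) x           ≈⟨ congruent (λ _ → sym (zeroˡ 0#)) x ⟩
      T (λ _ → 0# * 0#) x      ≈⟨ homogeneous 0# (λ _ → 0#) x ⟩
      0# * T (λ _ → 0#) x      ≈⟨ zeroˡ _ ⟩
      0#                       ∎

    negative : ∀ f x → T (λ y → - f y) x ≈ - T f x
    negative f x = begin
      T (λ y → - f y) x        ≈⟨ congruent (λ y → sym (-1*x≈-x (f y))) x ⟩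
      T (λ y → - 1# * f y) x   ≈⟨ homogeneous (- 1#) f x ⟩
      - 1# * T f x             ≈⟨ -1*x≈-x _ ⟩
      - T f x                  ∎

    subtractive : ∀ f g x → T (λ y → f y - g y) x ≈ T f x - T g x
    subtractive f g x = trans (additive f (λ y → - g y) x) (+-congˡ (negative g x))

    preserves-pair : ∀ {w} {W : Set w} (K : W → Functional) p x →
      T (λ y → pair (λ u → K u y) p) x ≈ pair (λ u → T (K u) x) p
    preserves-pair K []            x = zero-preserving x
    preserves-pair K ((a , u) ∷ p) x = trans (additive _ _ x)
      (+-cong (homogeneous a (K u) x) (preserves-pair K p x))

  open Linear

  -- The transposes of left multiplication by e_l and y on words, where a blocked product is rewritten
  -- as e_{l+1} y = y (y + e_l) or y′ y = 0. Being transposes, they compose in the order of T(E).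
  opE : ℕ → Functional → Functional
  opE l f []      = f ((l , 0) ∷ [])
  opE l f (b ∷ u) = if blocked l b then f (b ∷ b ∷ u) + f (b ∷ (proj₁ b , 0) ∷ u) else f ((l , 0) ∷ b ∷ u)

  opY : ℕ × ℕ → Functional → Functional
  -- y = 0 at the chosen vertex
  opY (l , zero)  f u       = 0#
  opY (l , suc k) f []      = f ((l , suc k) ∷ [])
  opY (l , suc k) f (b ∷ u) = if blocked l b then 0# else f ((l , suc k) ∷ b ∷ u)

  opE-linear : ∀ l → Linear (opE l)
  opE-linear l .congruent f≗g []      = f≗g _
  opE-linear l .congruent f≗g (b ∷ u) with blocked l b
  ... | true  = +-cong (f≗g _) (f≗g _)
  ... | false = f≗g _
  opE-linear l .additive f g []      = refl
  opE-linear l .additive f g (b ∷ u) with blocked l b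
  ... | true  = interchange _ _ _ _
  ... | false = refl
  opE-linear l .homogeneous a f []      = refl
  opE-linear l .homogeneous a f (b ∷ u) with blocked l b
  ... | true  = sym (distribˡ a _ _)
  ... | false = refl

  opY-linear : ∀ b → Linear (opY b)
  opY-linear (l , zero)  .congruent f≗g u = refl
  opY-linear (l , suc k) .congruent f≗g [] = f≗g _
  opY-linear (l , suc k) .congruent f≗g (b ∷ u) with blocked l b
  ... | true  = refl
  ... | false = f≗g _
  opY-linear (l , zero)  .additive f g u = sym (+-identityˡ 0#)
  opY-linear (l , suc k) .additive f g [] = refl
  opY-linear (l , suc k) .additive f g (b ∷ u) with blocked l b
  ... | true  = sym (+-identityˡ 0#)
  ... | false = refl
  opY-linear (l , zero)  .homogeneous a f u = sym (zeroʳ a)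
  opY-linear (l , suc k) .homogeneous a f [] = refl
  opY-linear (l , suc k) .homogeneous a f (b ∷ u) with blocked l b
  ... | true  = sym (zeroʳ a)
  ... | false = refl

  -- Here `f` is evaluated at y_{l+1} y_l x. Either y_l x is already 0, or y_l stands in front and
  -- is killed by y_{l+1}.
  opY-opY : ∀ l k k′ f x → opY (l , k′) (opY (suc l , k) f) x ≈ 0#
  opY-opY l k       zero     f x       = refl
  opY-opY l zero    (suc k′) f []      = refl
  opY-opY l zero    (suc k′) f (b ∷ u) with blocked l b
  ... | true  = refl
  ... | false = refl
  opY-opY l (suc k) (suc k′) f [] rewrite ≡ᵇ-refl l = refl
  opY-opY l (suc k) (suc k′) f (b ∷ u) with blocked l b
  ... | true  = refl
  ... | false rewrite ≡ᵇ-refl l = refl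

  -- The rule e_{l+1} y = y (y + e_l) applied to `x`. If `x` starts with a y' of the layer below,
  -- this is the overlap e_{l+1} y y'. The left side is 0 because y y' = 0; on the right y e_l y' =
  -- y y' (y' + e_{l-1}) = 0 as well.
  opY-opE : ∀ l k f x →
    opY (l , k) (opE (suc l) f) x ≈ opY (l , k) (opY (l , k) f) x + opE l (opY (l , k) f) x
  opY-opE l zero f []      = sym (+-identityˡ 0#)
  opY-opE l zero f (b ∷ u) with blocked l b
  ... | true  = sym (trans (+-identityˡ _) (+-identityˡ 0#))
  ... | false = sym (+-identityˡ 0#)
  opY-opE l (suc k) f [] rewrite ≡ᵇ-refl l | ≡ᵇ-suc l = refl
  opY-opE l (suc k) f (b ∷ u) with blocked l b
  ... | true  = sym (trans (+-identityˡ _) (+-identityˡ 0#))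
  ... | false rewrite ≡ᵇ-refl l | ≡ᵇ-suc l = refl

  -- The edge from (suc l , j) to (l , k) is e_{l+1} + y_j - y_k.
  opEdge : ℕ → ℕ → ℕ → Functional → Functional
  opEdge l j k f x = (opE (suc l) f x + opY (suc l , j) f x) - opY (l , k) f x

  opEdge-linear : ∀ l j k → Linear (opEdge l j k)
  opEdge-linear l j k .congruent f≗g x = +-cong
    (+-cong (congruent (opE-linear _) f≗g x) (congruent (opY-linear (suc l , j)) f≗g x))
    (-‿cong (congruent (opY-linear (l , k)) f≗g x))
  opEdge-linear l j k .additive f g x = begin
    opEdge l j k (λ y → f y + g y) x
      ≈⟨ +-cong (+-cong (additive (opE-linear _) f g x) (additive (opY-linear (suc l , j)) f g x))
                (-‿cong (additive (opY-linear (l , k)) f g x)) ⟩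
    ((E f + E g) + (Y f + Y g)) - (Z f + Z g)      ≈⟨ +-cong (interchange _ _ _ _) (sym (-‿+-comm _ _)) ⟩
    ((E f + Y f) + (E g + Y g)) + (- Z f - Z g)    ≈⟨ interchange _ _ _ _ ⟩
    opEdge l j k f x + opEdge l j k g x            ∎
    where
    E Y Z : Functional → Carrier
    E h = opE (suc l) h x
    Y h = opY (suc l , j) h x
    Z h = opY (l , k) h x
  opEdge-linear l j k .homogeneous a f x = begin
    opEdge l j k (λ y → a * f y) x
      ≈⟨ +-cong (+-cong (homogeneous (opE-linear _) a f x) (homogeneous (opY-linear (suc l , j)) a f x))
                (-‿cong (homogeneous (opY-linear (l , k)) a f x)) ⟩
    (a * E + a * Y) - a * Z     ≈⟨ +-congʳ (distribˡ a _ _) ⟨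
    a * (E + Y) - a * Z         ≈⟨ x[y-z]≈xy-xz a _ _ ⟨
    a * opEdge l j k f x        ∎
    where
    E = opE (suc l) f x
    Y = opY (suc l , j) f x
    Z = opY (l , k) f x

  -- The sum and the product of the edges of a path of length two from (suc (suc l) , j) to
  -- (l , k), which do not depend on the middle vertex.
  pathSum pathProduct : ℕ → ℕ → ℕ → Functional → Functional
  pathSum l j k f x =
    (opE (suc (suc l)) f x + opY (suc (suc l) , j) f x) + (opE (suc l) f x - opY (l , k) f x)
  pathProduct l j k f x =
    (opE (suc l) (opE (suc (suc l)) f) x + opE (suc l) (opY (suc (suc l) , j) f) x) -
    (opY (l , k) (opE (suc (suc l)) f) x + opY (l , k) (opY (suc (suc l) , j) f) x)

  opEdge-sum : ∀ l j k k′ f x → opEdge (suc l) j k f x + opEdge l k k′ f x ≈ pathSum l j k′ f x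
  opEdge-sum l j k k′ f x = begin
    (a - b) + ((d + b) - e)      ≈⟨ +-congˡ (+-congʳ (+-comm d b)) ⟩
    (a - b) + ((b + d) - e)      ≈⟨ +-congˡ (+-assoc b d (- e)) ⟩
    (a - b) + (b + (d - e))      ≈⟨ +-assoc (a - b) b _ ⟨
    ((a - b) + b) + (d - e)      ≈⟨ +-congʳ (//-rightDividesˡ b a) ⟩
    a + (d - e)                  ∎
    where
    a = opE (suc (suc l)) f x + opY (suc (suc l) , j) f x
    b = opY (suc l , k) f x
    d = opE (suc l) f x
    e = opY (l , k′) f x

  -- In (e_{l+2} + y_j - y_k)(e_{l+1} + y_k - y_{k′}) the products y_j y_k and y_k y_{k′} are 0, and
  -- e_{l+2} y_k cancels against y_k e_{l+1} + y_k y_k. Nothing with the middle vertex `k` is left.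
  opEdge-comp : ∀ l j k k′ f x → opEdge l k k′ (opEdge (suc l) j k f) x ≈ pathProduct l j k′ f x
  opEdge-comp l j k k′ f x = begin
    (E g x + Y g x) - Z g x
      ≈⟨ +-cong (+-cong (expand (opE-linear (suc l))) (expand (opY-linear (suc l , k)))) (-‿cong (expand (opY-linear (l , k′)))) ⟩
    ((a + b - d) + (Y Ef x + Y Yf x - s)) - (p + q - Z Wf x)
      ≈⟨ +-cong (+-congˡ (+-congʳ (+-cong (opY-opE (suc l) k f x) (opY-opY (suc l) j k f x))))
                (-‿cong (+-congˡ (-‿cong (opY-opY l k k′ f x)))) ⟩
    ((a + b - d) + ((s + d + 0#) - s)) - (p + q - 0#)
      ≈⟨ +-cong (+-congˡ (+-congʳ (+-identityʳ _))) (-‿cong (trans (+-congˡ -0#≈0#) (+-identityʳ _))) ⟩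
    ((a + b - d) + ((s + d) - s)) - (p + q)
      ≈⟨ +-congʳ (+-congˡ (xyx⁻¹≈y s d)) ⟩
    ((a + b - d) + d) - (p + q)
      ≈⟨ +-congʳ (//-rightDividesˡ d (a + b)) ⟩
    (a + b) - (p + q) ∎
    where
    E Y Z : Functional → Functional
    E = opE (suc l)
    Y = opY (suc l , k)
    Z = opY (l , k′)
    Ef Yf Wf g : Functional
    Ef = opE (suc (suc l)) f
    Yf = opY (suc (suc l) , j) f
    Wf = opY (suc l , k) f
    g = opEdge (suc l) j k f
    a = E Ef x
    b = E Yf x
    d = E Wf x
    s = Y Wf x
    p = Z Ef x
    q = Z Yf x
    expand : ∀ {T} → Linear T → T g x ≈ T Ef x + T Yf x - T Wf x
    expand T-lin = trans (subtractive T-lin _ Wf x) (+-congʳ (additive T-lin Ef Yf x))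

  -- Edges, diamonds and paths acting on functionals

  act₁ : Edge → Functional → Functional
  act₁ (i , v , w) = opEdge (toℕ i) (toℕ v) (toℕ w)

  act₁-linear : ∀ e → Linear (act₁ e)
  act₁-linear (i , v , w) = opEdge-linear (toℕ i) (toℕ v) (toℕ w)

  -- Forgets the bound on the vertex number, so that an equation between vertices of propositionally
  -- equal layers rewrites the numeric arguments of `opEdge` by congruence.
  κ : Vertex → ℕ × ℕ
  κ (l , v) = l , toℕ v

  source target : Edge → ℕ
  source (i , v , w) = toℕ v
  target (i , v , w) = toℕ w

  act₁-descend : ∀ {e e′} → head e ≡ tail e′ →
    act₁ e ≡ opEdge (suc (proj₁ (head e′))) (source e) (source e′)
  act₁-descend {e} eq = ≡.cong (λ v → opEdge (proj₁ (κ v)) (source e) (proj₂ (κ v))) eq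

  act₁-sum : ∀ {e e′} → head e ≡ tail e′ → ∀ f x →
    act₁ e f x + act₁ e′ f x ≈ pathSum (proj₁ (head e′)) (source e) (target e′) f x
  act₁-sum {e} {e′} eq f x = trans
    (reflexive (≡.cong (λ T → T f x + act₁ e′ f x) (act₁-descend {e} {e′} eq)))
    (opEdge-sum (proj₁ (head e′)) (source e) (source e′) (target e′) f x)

  act₁-comp : ∀ {e e′} → head e ≡ tail e′ → ∀ f x →
    act₁ e′ (act₁ e f) x ≈ pathProduct (proj₁ (head e′)) (source e) (target e′) f x
  act₁-comp {e} {e′} eq f x = trans
    (reflexive (≡.cong (λ T → act₁ e′ (T f) x) (act₁-descend {e} {e′} eq)))
    (opEdge-comp (proj₁ (head e′)) (source e) (source e′) (target e′) f x)

  module _ {e₁ e₂ e₁′ e₂′ : Edge}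
    (top : tail e₁ ≡ tail e₁′) (mid : head e₁ ≡ tail e₂) (mid′ : head e₁′ ≡ tail e₂′)
    (bot : head e₂ ≡ head e₂′) where

    private
      ends : ∀ (T : ℕ → ℕ → ℕ → Functional → Functional) f x →
        T (proj₁ (head e₂)) (source e₁) (target e₂) f x ≈ T (proj₁ (head e₂′)) (source e₁′) (target e₂′) f x
      ends T f x = reflexive (≡.cong₂ (λ u v → T (proj₁ (κ v)) (proj₂ (κ u)) (proj₂ (κ v)) f x) top bot)

    diamond-sum : ∀ f x → act₁ e₁ f x + act₁ e₂ f x ≈ act₁ e₁′ f x + act₁ e₂′ f x
    diamond-sum f x = trans (act₁-sum {e₁} {e₂} mid f x)
      (trans (ends pathSum f x) (sym (act₁-sum {e₁′} {e₂′} mid′ f x)))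

    diamond-comp : ∀ f x → act₁ e₂ (act₁ e₁ f) x ≈ act₁ e₂′ (act₁ e₁′ f) x
    diamond-comp f x = trans (act₁-comp {e₁} {e₂} mid f x)
      (trans (ends pathProduct f x) (sym (act₁-comp {e₁′} {e₂′} mid′ f x)))

  -- The coefficients, by falling powers of τ, of a polynomial in τ with values in the functionals;
  -- shift g e is its product with τ - e.
  Sequence : Set c
  Sequence = ℕ → Functional

  shift : Sequence → Edge → Sequence
  shift g e zero    x = g 0 x
  shift g e (suc k) x = g (suc k) x - act₁ e (g k) x

  infix 4 _≋_
  _≋_ : Sequence → Sequence → Set ℓ
  g ≋ h = ∀ k x → g k x ≈ h k x

  shift-cong : ∀ {g h} e → g ≋ h → shift g e ≋ shift h e
  shift-cong e g≋h zero    x = g≋h 0 x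
  shift-cong e g≋h (suc k) x = +-cong (g≋h (suc k) x) (-‿cong (congruent (act₁-linear e) (g≋h k) x))

  run-cong : ∀ {g h} es → g ≋ h → foldl shift g es ≋ foldl shift h es
  run-cong []       g≋h = g≋h
  run-cong (e ∷ es) g≋h = run-cong es (shift-cong e g≋h)

  -- The product (τ - e₁)(τ - e₂) involves the edges only through e₁ + e₂ and e₁ e₂, and both act
  -- equally along the two sides of a diamond.
  diamond : ∀ {e₁ e₂ e₁′ e₂′} → tail e₁ ≡ tail e₁′ → head e₁ ≡ tail e₂ → head e₁′ ≡ tail e₂′ →
    head e₂ ≡ head e₂′ → ∀ g → shift (shift g e₁) e₂ ≋ shift (shift g e₁′) e₂′
  diamond {e₁} {e₂} {e₁′} {e₂′} top mid mid′ bot g = go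
    where
    regroup : ∀ a b d → (a - b) - d ≈ a - (b + d)
    regroup a b d = trans (+-assoc a (- b) (- d)) (+-congˡ (-‿+-comm b d))
    regroup₂ : ∀ a b d e → (a - b) - (d - e) ≈ (a - (b + d)) + e
    regroup₂ a b d e = begin
      (a - b) - (d - e)     ≈⟨ +-congˡ (-‿+-comm d (- e)) ⟨
      (a - b) + (- d - - e) ≈⟨ +-congˡ (+-congˡ (-‿involutive e)) ⟩
      (a - b) + (- d + e)   ≈⟨ +-assoc (a - b) (- d) e ⟨
      ((a - b) - d) + e     ≈⟨ +-congʳ (regroup a b d) ⟩
      (a - (b + d)) + e     ∎
    expand : ∀ e₁ e₂ k x → shift (shift g e₁) e₂ (suc (suc k)) x ≈
      (g (suc (suc k)) x - (act₁ e₁ (g (suc k)) x + act₁ e₂ (g (suc k)) x)) + act₁ e₂ (act₁ e₁ (g k)) x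
    expand e₁ e₂ k x = trans
      (+-congˡ (-‿cong (subtractive (act₁-linear e₂) (g (suc k)) (act₁ e₁ (g k)) x)))
      (regroup₂ _ _ _ _)
    go : shift (shift g e₁) e₂ ≋ shift (shift g e₁′) e₂′
    go zero          x = refl
    go (suc zero)    x = begin
      (g 1 x - act₁ e₁ (g 0) x) - act₁ e₂ (g 0) x     ≈⟨ regroup _ _ _ ⟩
      g 1 x - (act₁ e₁ (g 0) x + act₁ e₂ (g 0) x)     ≈⟨ +-congˡ (-‿cong (diamond-sum {e₁} {e₂} {e₁′} {e₂′} top mid mid′ bot (g 0) x)) ⟩
      g 1 x - (act₁ e₁′ (g 0) x + act₁ e₂′ (g 0) x)   ≈⟨ regroup _ _ _ ⟨
      (g 1 x - act₁ e₁′ (g 0) x) - act₁ e₂′ (g 0) x   ∎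
    go (suc (suc k)) x = trans (expand e₁ e₂ k x) (trans
      (+-cong (+-congˡ (-‿cong (diamond-sum {e₁} {e₂} {e₁′} {e₂′} top mid mid′ bot (g (suc k)) x)))
              (diamond-comp {e₁} {e₂} {e₁′} {e₂′} top mid mid′ bot (g k) x))
      (sym (expand e₁′ e₂′ k x)))

  edge-ext : ∀ {e e′} → tail e ≡ tail e′ → head e ≡ head e′ → e ≡ e′
  edge-ext {i , v , w} {i′ , v′ , w′} t h with FinP.toℕ-injective (≡.cong proj₁ h)
  edge-ext {i , v , w} {i , v , w} ≡.refl ≡.refl | ≡.refl = ≡.refl

  path-level : ∀ e r → IsPath (e ∷ r) → proj₁ (head e) ≡ length r ℕ.+ proj₁ (head (lastE e r))
  path-level e []       _                   = ≡.refl
  path-level e (e′ ∷ r) (cons _ _ _ eq path) =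
    ≡.trans (≡.cong proj₁ eq) (≡.cong suc (path-level e′ r path))

  -- The layer drops by one along every edge, so the layers of the two ends determine the length.
  path-length : ∀ e₁ r₁ e₂ r₂ → IsPath (e₁ ∷ r₁) → IsPath (e₂ ∷ r₂) → tail e₁ ≡ tail e₂ →
    head (lastE e₁ r₁) ≡ head (lastE e₂ r₂) → length r₁ ≡ length r₂
  path-length e₁ r₁ e₂ r₂ p₁ p₂ t h = ℕP.+-cancelʳ-≡ (proj₁ (head (lastE e₂ r₂))) (length r₁) (length r₂)
    (≡.trans (≡.cong (λ v → length r₁ ℕ.+ proj₁ v) (≡.sym h))
      (≡.trans (≡.sym (path-level e₁ r₁ p₁))
        (≡.trans (ℕP.suc-injective (≡.cong proj₁ t)) (path-level e₂ r₂ p₂))))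

  -- Completeness of the graph: this is the edge that closes the diamond in `paths-agree`.
  crossing : ∀ e e′ → proj₁ (tail e) ≡ proj₁ (tail e′) → Σ Edge λ f → tail f ≡ tail e′ × head f ≡ head e
  crossing (i , v , w) (i′ , v′ , w′) eq with FinP.toℕ-injective (ℕP.suc-injective eq)
  ... | ≡.refl = (i , v′ , w) , ≡.refl , ≡.refl

  replace-first : ∀ {e e′} r → head e′ ≡ head e → IsPath (e ∷ r) →
    IsPath (e′ ∷ r) × head (lastE e′ r) ≡ head (lastE e r)
  replace-first []      eq _                     = one _ , eq
  replace-first (f ∷ r) eq (cons _ _ _ eq′ path) = cons _ _ _ (≡.trans eq eq′) path , ≡.refl

  -- The first interior vertex of one path is moved to that of the other across a diamond.
  paths-agree : ∀ e₁ r₁ e₂ r₂ → IsPath (e₁ ∷ r₁) → IsPath (e₂ ∷ r₂) → tail e₁ ≡ tail e₂ →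
    head (lastE e₁ r₁) ≡ head (lastE e₂ r₂) →
    ∀ g → foldl shift g (e₁ ∷ r₁) ≋ foldl shift g (e₂ ∷ r₂)
  paths-agree e₁ [] e₂ [] _ _ t h g k x with edge-ext {e₁} {e₂} t h
  ... | ≡.refl = refl
  paths-agree e₁ [] e₂ (f₂ ∷ s₂) p₁ p₂ t h g =
    contradiction (path-length e₁ [] e₂ (f₂ ∷ s₂) p₁ p₂ t h) λ ()
  paths-agree e₁ (f₁ ∷ s₁) e₂ [] p₁ p₂ t h g =
    contradiction (path-length e₁ (f₁ ∷ s₁) e₂ [] p₁ p₂ t h) λ ()
  paths-agree e₁ (f₁ ∷ s₁) e₂ (f₂ ∷ s₂) (cons _ _ _ eq₁ q₁) (cons _ _ _ eq₂ q₂) t h g k x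
    with crossing f₁ f₂ (≡.trans (≡.cong proj₁ (≡.sym eq₁))
           (≡.trans (ℕP.suc-injective (≡.cong proj₁ t)) (≡.cong proj₁ eq₂)))
  ... | f , tf , hf = trans
    (run-cong s₁ (diamond {e₁} {f₁} {e₂} {f} t eq₁ (≡.trans eq₂ (≡.sym tf)) (≡.sym hf) g) k x)
    (paths-agree f s₁ f₂ s₂ (proj₁ moved) q₂ tf (≡.trans (proj₂ moved) h) (shift g e₂) k x)
    where
    moved = replace-first {f₁} {f} s₁ hf q₁

  -- The relations of the algebra act as zero

  actWord : Word → Functional → Functional
  actWord []      f = f
  actWord (e ∷ u) f = actWord u (act₁ e f)

  actWord-++ : ∀ u v f → actWord (u ++ v) f ≡ actWord v (actWord u f)
  actWord-++ []      v f = ≡.refl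
  actWord-++ (e ∷ u) v f = actWord-++ u v (act₁ e f)

  actWord-linear : ∀ u → Linear (actWord u)
  actWord-linear []      .congruent f≗g       = f≗g
  actWord-linear []      .additive f g x      = refl
  actWord-linear []      .homogeneous a f x   = refl
  actWord-linear (e ∷ u) .congruent f≗g       = congruent (actWord-linear u) (congruent (act₁-linear e) f≗g)
  actWord-linear (e ∷ u) .additive f g x      =
    trans (congruent (actWord-linear u) (additive (act₁-linear e) f g) x) (additive (actWord-linear u) _ _ x)
  actWord-linear (e ∷ u) .homogeneous a f x   =
    trans (congruent (actWord-linear u) (homogeneous (act₁-linear e) a f) x) (homogeneous (actWord-linear u) a _ x)

  act : Poly → Functional → Functional
  act p f x = pair (λ u → actWord u f x) p

  act-linear : ∀ p → Linear (act p)
  act-linear p .congruent f≗g x     = pair-cong (λ u → congruent (actWord-linear u) f≗g x) p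
  act-linear p .additive f g x      = trans (pair-cong (λ u → additive (actWord-linear u) f g x) p) (pair-+ _ _ p)
  act-linear p .homogeneous a f x   = trans (pair-cong (λ u → homogeneous (actWord-linear u) a f x) p) (pair-* a _ p)

  act-*P : ∀ p q f x → act (p *P q) f x ≈ act q (act p f) x
  act-*P p q f x = begin
    pair (λ w → actWord w f x) (p *P q)                         ≈⟨ pair-*P _ p q ⟩
    pair (λ u → pair (λ v → actWord (u ++ v) f x) q) p
      ≈⟨ pair-cong (λ u → pair-cong (λ v → reflexive (≡.cong (λ g → g x) (actWord-++ u v f))) q) p ⟩
    pair (λ u → act q (actWord u f) x) p                        ≈⟨ preserves-pair (act-linear q) (λ u → actWord u f) p x ⟨
    act q (act p f) x                                           ∎

  act-edgeP : ∀ e f x → act (edgeP e) f x ≈ act₁ e f x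
  act-edgeP e f x = pair-singleton (λ u → actWord u f x) (e ∷ [])

  act-minus : ∀ p q f x → act (p -P q) f x ≈ act p f x - act q f x
  act-minus p q f x = pair-minus _ p q

  coefficients : List Poly → Functional → Sequence
  coefficients cs f k = act (nth cs k) f

  -- Behind the leading entry of `stepτ` the list of products lags one index behind the list from
  -- which it is subtracted; `d` is the coefficient just passed. The appended `0P` supplies the last
  -- minuend.
  nth-zipWith : ∀ cs d e k → nth (zipWith _-P_ (cs ++ 0P ∷ []) (map (λ x → x *P edgeP e) (d ∷ cs))) k ≡
    nth cs k -P (nth (d ∷ cs) k *P edgeP e)
  nth-zipWith []       d e zero    = ≡.refl
  nth-zipWith []       d e (suc k) = ≡.refl
  nth-zipWith (c ∷ cs) d e zero    = ≡.refl
  nth-zipWith (c ∷ cs) d e (suc k) = nth-zipWith cs c e k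

  coefficients-stepτ : ∀ cs e f → coefficients (stepτ cs e) f ≋ shift (coefficients cs f) e
  coefficients-stepτ []       e f zero    x = refl
  coefficients-stepτ (c ∷ cs) e f zero    x = reflexive (≡.cong (λ p → act p f x) (ListP.++-identityʳ c))
  coefficients-stepτ []       e f (suc k) x =
    sym (trans (+-identityˡ _) (trans (-‿cong (zero-preserving (act₁-linear e) x)) -0#≈0#))
  coefficients-stepτ (c ∷ cs) e f (suc k) x = begin
    act (nth (stepτ (c ∷ cs) e) (suc k)) f x           ≡⟨ ≡.cong (λ p → act p f x) (nth-zipWith cs c e k) ⟩
    act (nth cs k -P (q *P edgeP e)) f x               ≈⟨ act-minus (nth cs k) (q *P edgeP e) f x ⟩
    act (nth cs k) f x - act (q *P edgeP e) f x        ≈⟨ +-congˡ (-‿cong (trans (act-*P q (edgeP e) f x) (act-edgeP e _ x))) ⟩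
    act (nth cs k) f x - act₁ e (act q f) x            ∎
    where
    q = nth (c ∷ cs) k

  coefficients-path : ∀ cs π f → coefficients (foldl stepτ cs π) f ≋ foldl shift (coefficients cs f) π
  coefficients-path cs []      f k x = refl
  coefficients-path cs (e ∷ π) f k x = trans (coefficients-path (stepτ cs e) π f k x)
    (run-cong π (coefficients-stepτ cs e f) k x)

  act-gen : ∀ g f x → act (genPoly g) f x ≈ 0#
  act-gen g f x = trans (act-minus (eπ (e₁ ∷ r₁) k) (eπ (e₂ ∷ r₂) k) f x) (x≈y⇒x∙y⁻¹≈ε (begin
    act (eπ (e₁ ∷ r₁) k) f x                                   ≈⟨ coefficients-path (1P ∷ []) (e₁ ∷ r₁) f k x ⟩
    foldl shift (coefficients (1P ∷ []) f) (e₁ ∷ r₁) k x       ≈⟨ paths-agree e₁ r₁ e₂ r₂ path₁ path₂ sameTail sameHead _ k x ⟩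
    foldl shift (coefficients (1P ∷ []) f) (e₂ ∷ r₂) k x       ≈⟨ coefficients-path (1P ∷ []) (e₂ ∷ r₂) f k x ⟨
    act (eπ (e₂ ∷ r₂) k) f x                                   ∎))
    where open Gen g

  act-relator : ∀ t f x → act (relator t) f x ≈ 0#
  act-relator (a , g , b) f x = begin
    act ((a *P genPoly g) *P b) f x          ≈⟨ act-*P (a *P genPoly g) b f x ⟩
    act b (act (a *P genPoly g) f) x         ≈⟨ congruent (act-linear b) (λ y → trans (act-*P a (genPoly g) f y) (act-gen g _ y)) x ⟩
    act b (λ _ → 0#) x                       ≈⟨ zero-preserving (act-linear b) x ⟩
    0#                                       ∎

  act-ideal : ∀ {p} → Ideal p → ∀ f x → act p f x ≈ 0#
  act-ideal {p} (mkIdeal L p≐) f x = trans (at p≐ _) (go L)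
    where
    go : ∀ L → act (combination L) f x ≈ 0#
    go []      = refl
    go (t ∷ L) = trans (pair-++ _ (relator t) (combination L))
      (trans (+-cong (act-relator t f x) (go L)) (+-identityˡ 0#))

-- The basis of normal words

predecessor : ∀ {n} (i : Fin n) → toℕ i ≢ 0 → Σ (Fin n) λ j → toℕ i ≡ suc (toℕ j)
predecessor Fin.zero    i≢0 = contradiction ≡.refl i≢0
predecessor (Fin.suc i) i≢0 = Fin.inject₁ i , ≡.cong suc (≡.sym (FinP.toℕ-inject₁ i))

module RingIdentities {a b} (R : Ring a b) where
  open Ring R
  open RingProperties R
  open SetoidReasoning setoid

  -- The left sides of this identity and the next are what `eπ` unfolds to at indices 1 and 2 for a
  -- path of two edges.
  linear-coefficient : ∀ x y → (0# - 1# * x) - ((1# - 0#) * y) ≈ - (x + y)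
  linear-coefficient x y = begin
    (0# - 1# * x) - ((1# - 0#) * y)   ≈⟨ +-cong (+-identityˡ _) (-‿cong (*-congʳ (trans (+-congˡ -0#≈0#) (+-identityʳ 1#)))) ⟩
    - (1# * x) - 1# * y               ≈⟨ +-cong (-‿cong (*-identityˡ x)) (-‿cong (*-identityˡ y)) ⟩
    - x - y                           ≈⟨ -‿+-comm x y ⟩
    - (x + y)                         ∎

  quadratic-coefficient : ∀ x y → 0# - ((0# - 1# * x) * y) ≈ x * y
  quadratic-coefficient x y = begin
    0# - ((0# - 1# * x) * y)          ≈⟨ +-identityˡ _ ⟩
    - ((0# - 1# * x) * y)             ≈⟨ -‿cong (*-congʳ (trans (+-identityˡ _) (-‿cong (*-identityˡ x)))) ⟩
    - (- x * y)                       ≈⟨ -‿cong (-‿distribˡ-* x y) ⟨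
    - - (x * y)                       ≈⟨ -‿involutive _ ⟩
    x * y                             ∎

  exchange : ∀ x y z w → x + y ≈ z + w → x ≈ z - (y - w)
  exchange x y z w eq = begin
    x                 ≈⟨ //-rightDividesʳ y x ⟨
    (x + y) - y       ≈⟨ +-congʳ eq ⟩
    (z + w) - y       ≈⟨ +-assoc z w (- y) ⟩
    z + (w - y)       ≈⟨ +-congˡ (⁻¹-anti-homo‿- y w) ⟨
    z - (y - w)       ∎

  -- x y - x z = x y - d y = (x - d) y, and x - d = y - z. It is used with d the edge from v to w, x
  -- = D v, y = D w and z = D *.
  quadratic-relation : ∀ d x y z → d ≈ x - (y - z) → d * y ≈ x * z → x * (y - z) ≈ (y - z) * y
  quadratic-relation d x y z linear product = begin
    x * (y - z)                            ≈⟨ x[y-z]≈xy-xz x y z ⟩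
    x * y - x * z                          ≈⟨ +-congˡ (-‿cong product) ⟨
    x * y - d * y                          ≈⟨ +-congˡ (-‿cong (*-congʳ linear)) ⟩
    x * y - (x - (y - z)) * y              ≈⟨ [y-z]x≈yx-zx y x _ ⟨
    (x - (x - (y - z))) * y                ≈⟨ *-congʳ (+-congˡ (⁻¹-anti-homo‿- x (y - z))) ⟩
    (x + ((y - z) - x)) * y                ≈⟨ *-congʳ (trans (sym (+-assoc x (y - z) (- x))) (xyx⁻¹≈y x (y - z))) ⟩
    (y - z) * y                            ∎

module Basis {c ℓ} (F : Field c ℓ) (n : ℕ) (m : ℕ → ℕ) (pos : ∀ i → 1 ≤ i → i ≤ n → 1 ≤ m i) where
  open Field F hiding (zero)
  open Construction F n m
  open RingProperties ring
  open Pairing F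
  open FreeAlgebra F n m
  open Representation F n m
  open NormalWords n m pos
  open SemiringSum semiring using (∑-distrib-+; *-distribˡ-sum) renaming (sum to ∑; sum-cong-≋ to ∑-cong)
  open SetoidReasoning setoid
  private
    module P = Ring polyRing
    module A = Ring A
    module AP = RingProperties A

  *P-congˡ : ∀ q {p p′} → p ~ p′ → q *P p ~ q *P p′
  *P-congˡ q p~p′ = A.*-cong (A.refl {q}) p~p′

  *P-congʳ : ∀ q {p p′} → p ~ p′ → p *P q ~ p′ *P q
  *P-congʳ q p~p′ = A.*-cong p~p′ (A.refl {q})

  layer-pos : ∀ l → l ≤ n → 1 ≤ layer m l
  layer-pos zero    _   = s≤s z≤n
  layer-pos (suc l) l≤n = pos (suc l) (s≤s z≤n) l≤n

  -- The chosen vertex at the head end of the edges indexed by `i`, whereas `star i` is the one at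
  -- their tail end. Layer 0, where no positivity hypothesis on `m` applies, is included here.
  bottom : ∀ i → Fin (layer m (toℕ i))
  bottom i = fromℕ< (layer-pos (toℕ i) (ℕP.<⇒≤ (FinP.toℕ<n i)))

  toℕ-bottom : ∀ i → toℕ (bottom i) ≡ 0
  toℕ-bottom i = FinP.toℕ-fromℕ< (layer-pos (toℕ i) (ℕP.<⇒≤ (FinP.toℕ<n i)))

  descending : Letter → Poly
  descending (i , v) = edgeP (i , v , bottom i)

  starred : Fin n → Letter
  starred i = i , star i

  letterP : Letter → Poly
  letterP (i , v) with toℕ v ℕ.≟ 0
  ... | yes _ = descending (i , v)
  ... | no  _ = descending (i , v) -P descending (starred i)

  letterP-≡0 : ∀ i v → toℕ v ≡ 0 → letterP (i , v) ≡ descending (i , v)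
  letterP-≡0 i v v≡0 with toℕ v ℕ.≟ 0
  ... | yes _  = ≡.refl
  ... | no v≢0 = contradiction v≡0 v≢0

  letterP-≢0 : ∀ i v → toℕ v ≢ 0 → letterP (i , v) ≡ descending (i , v) -P descending (starred i)
  letterP-≢0 i v v≢0 with toℕ v ℕ.≟ 0
  ... | yes v≡0 = contradiction v≡0 v≢0
  ... | no _    = ≡.refl

  wordP : List Letter → Poly
  wordP []      = 1P
  wordP (a ∷ u) = letterP a *P wordP u

  -- Relations between the letters in the quotient

  module _ {e₁ e₂ e₁′ e₂′ : Edge}
    (top : tail e₁ ≡ tail e₁′) (mid : head e₁ ≡ tail e₂) (mid′ : head e₁′ ≡ tail e₂′)
    (bot : head e₂ ≡ head e₂′) where

    private
      gen : ∀ k → 1 ≤ k → k ≤ 2 → Gen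
      gen k 1≤k k≤2 = record
        { e₁ = e₁ ; e₂ = e₁′ ; r₁ = e₂ ∷ [] ; r₂ = e₂′ ∷ []
        ; path₁ = cons _ _ _ mid (one _) ; path₂ = cons _ _ _ mid′ (one _)
        ; sameTail = top ; sameHead = bot ; k = k ; 1≤k = 1≤k ; k≤len = k≤2 }

    relation-sum : edgeP e₁ +P edgeP e₂ ~ edgeP e₁′ +P edgeP e₂′
    -- The coefficient at index 1 is minus the sum of the two edges, so a sign has to be cancelled.
    relation-sum = AP.-‿injective (A.trans (A.sym (coefficient e₁ e₂))
      (A.trans (mk~ (Ideal-gen (gen 1 (s≤s z≤n) (s≤s z≤n)))) (coefficient e₁′ e₂′)))
      where
      coefficient : ∀ e f → eπ (e ∷ f ∷ []) 1 ~ -P (edgeP e +P edgeP f)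
      coefficient e f = ≐⇒~ (RingIdentities.linear-coefficient polyRing (edgeP e) (edgeP f))

    relation-product : edgeP e₁ *P edgeP e₂ ~ edgeP e₁′ *P edgeP e₂′
    relation-product = A.trans (A.sym (coefficient e₁ e₂))
      (A.trans (mk~ (Ideal-gen (gen 2 (s≤s z≤n) (s≤s (s≤s z≤n))))) (coefficient e₁′ e₂′))
      where
      coefficient : ∀ e f → eπ (e ∷ f ∷ []) 2 ~ edgeP e *P edgeP f
      coefficient e f = ≐⇒~ (RingIdentities.quadratic-coefficient polyRing (edgeP e) (edgeP f))

  module _ (i j : Fin n) (i≡1+j : toℕ i ≡ suc (toℕ j)) where

    -- The tail layer of edges indexed by `j` and the head layer of edges indexed by `i` agree only
    -- propositionally; vertices are moved from the former to the latter.
    raise : Fin (layer m (suc (toℕ j))) → Fin (layer m (toℕ i))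
    raise = ≡.subst (λ l → Fin (layer m l)) (≡.sym i≡1+j)

    toℕ-raise : ∀ w → toℕ (raise w) ≡ toℕ w
    toℕ-raise w = go (≡.sym i≡1+j) w
      where
      go : ∀ {k l} (p : k ≡ l) w → toℕ (≡.subst (λ l → Fin (layer m l)) p w) ≡ toℕ w
      go ≡.refl w = ≡.refl

    raise-vertex : ∀ w → _≡_ {A = Vertex} (toℕ i , raise w) (suc (toℕ j) , w)
    raise-vertex w = go (≡.sym i≡1+j) w
      where
      go : ∀ {k l} (p : k ≡ l) w → _≡_ {A = Vertex} (l , ≡.subst (λ l → Fin (layer m l)) p w) (k , w)
      go ≡.refl w = ≡.refl

    raise-star : raise (star j) ≡ bottom i
    raise-star = FinP.toℕ-injective
      (≡.trans (toℕ-raise (star j)) (≡.trans (toℕ-star j) (≡.sym (toℕ-bottom i))))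

    raise-star-vertex : _≡_ {A = Vertex} (toℕ i , bottom i) (suc (toℕ j) , star j)
    raise-star-vertex = ≡.trans (≡.cong (toℕ i ,_) (≡.sym raise-star)) (raise-vertex (star j))

    edge-linear : ∀ v w → edgeP (i , v , raise w) ~
      descending (i , v) -P (descending (j , w) -P descending (starred j))
    edge-linear v w = RingIdentities.exchange A (edgeP (i , v , raise w)) (descending (j , w)) (descending (i , v)) (descending (starred j))
      (relation-sum {i , v , raise w} {j , w , bottom j} {i , v , bottom i} {j , star j , bottom j}
        ≡.refl (raise-vertex w) raise-star-vertex ≡.refl)

    edge-quadratic : ∀ v w →
      descending (i , v) *P (descending (j , w) -P descending (starred j)) ~
      (descending (j , w) -P descending (starred j)) *P descending (j , w)
    edge-quadratic v w = RingIdentities.quadratic-relation A (edgeP (i , v , raise w)) (descending (i , v)) (descending (j , w)) (descending (starred j))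
      (edge-linear v w)
      (relation-product {i , v , raise w} {j , w , bottom j} {i , v , bottom i} {j , star j , bottom j}
        ≡.refl (raise-vertex w) raise-star-vertex ≡.refl)

  descending-sum : ∀ j w → toℕ w ≢ 0 → descending (j , w) ~ letterP (j , w) +P letterP (starred j)
  descending-sum j w w≢0 rewrite letterP-≢0 j w w≢0 | letterP-≡0 j (star j) (toℕ-star j) =
    A.sym (AP.//-rightDividesˡ (descending (starred j)) (descending (j , w)))

  letters-star : ∀ i j v w → toℕ i ≡ suc (toℕ j) → toℕ v ≡ 0 → toℕ w ≢ 0 →
    letterP (i , v) *P letterP (j , w) ~ letterP (j , w) *P (letterP (j , w) +P letterP (starred j))
  letters-star i j v w i≡1+j v≡0 w≢0 = A.trans
    (≡.subst₂ (λ p q → p *P q ~ q *P descending (j , w))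
      (≡.sym (letterP-≡0 i v v≡0)) (≡.sym (letterP-≢0 j w w≢0)) (edge-quadratic i j i≡1+j v w))
    (*P-congˡ (letterP (j , w)) (descending-sum j w w≢0))

  -- The right side of `edge-quadratic` does not depend on `v`, so subtracting its instance at
  -- `star i` leaves 0.
  letters-zero : ∀ i j v w → toℕ i ≡ suc (toℕ j) → toℕ v ≢ 0 → toℕ w ≢ 0 →
    letterP (i , v) *P letterP (j , w) ~ 0P
  letters-zero i j v w i≡1+j v≢0 w≢0 =
    ≡.subst₂ (λ p q → p *P q ~ 0P) (≡.sym (letterP-≢0 i v v≢0)) (≡.sym (letterP-≢0 j w w≢0))
      (A.trans (AP.[y-z]x≈yx-zx (descending (j , w) -P descending (starred j)) (descending (i , v)) (descending (starred i)))
        (AP.x≈y⇒x∙y⁻¹≈ε (A.trans (edge-quadratic i j i≡1+j v w) (A.sym (edge-quadratic i j i≡1+j (star i) w)))))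

  -- The normal words span

  basisWord : ∀ d → Fin (count d 0) → List Letter
  basisWord d = lookup (normalWords d 0)

  basis : ∀ d → Fin (count d 0) → Poly
  basis d j = wordP (basisWord d j)

  pair-lincomb : ∀ {r} (λs : Fin r → Carrier) (x : Fin r → Poly) f →
    pair f (lincomb λs x) ≈ ∑ (λ j → λs j * pair f (x j))
  pair-lincomb λs x f = go (λ j → j)
    where
    go : ∀ {r} (h : Fin r → _) → pair f (concatMap (λ j → scaleP (λs j) (x j)) (tabulate h)) ≈
      ∑ (λ j → λs (h j) * pair f (x (h j)))
    go {zero}  h = refl
    go {suc r} h = trans (pair-++ f (scaleP (λs (h Fin.zero)) (x (h Fin.zero))) _)
      (+-cong (pair-scaleP f (λs (h Fin.zero)) (x (h Fin.zero))) (go (h ∘ Fin.suc)))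

  ∑-zero : ∀ {r} (t : Fin r → Carrier) → (∀ i → t i ≈ 0#) → ∑ t ≈ 0#
  ∑-zero {zero}  t t≈0 = refl
  ∑-zero {suc r} t t≈0 = trans (+-cong (t≈0 Fin.zero) (∑-zero (t ∘ Fin.suc) (t≈0 ∘ Fin.suc))) (+-identityˡ 0#)

  ∑-single : ∀ {r} (t : Fin r → Carrier) j → (∀ i → i ≢ j → t i ≈ 0#) → ∑ t ≈ t j
  ∑-single {suc r} t Fin.zero    t≈0 =
    trans (+-congˡ (∑-zero (t ∘ Fin.suc) (λ i → t≈0 (Fin.suc i) λ ()))) (+-identityʳ _)
  ∑-single {suc r} t (Fin.suc j) t≈0 = trans
    (+-cong (t≈0 Fin.zero λ ()) (∑-single (t ∘ Fin.suc) j (λ i i≢j → t≈0 (Fin.suc i) (i≢j ∘ FinP.suc-injective))))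
    (+-identityˡ _)

  indicator : ∀ {r} → Fin r → Fin r → Carrier
  indicator j i with i Fin.≟ j
  ... | yes _ = 1#
  ... | no  _ = 0#

  indicator-≡ : ∀ {r} (j : Fin r) → indicator j j ≈ 1#
  indicator-≡ j with j Fin.≟ j
  ... | yes _ = refl
  ... | no ¬p = contradiction ≡.refl ¬p

  indicator-≢ : ∀ {r} {j i : Fin r} → i ≢ j → indicator j i ≈ 0#
  indicator-≢ {j = j} {i} i≢j with i Fin.≟ j
  ... | yes p = contradiction p i≢j
  ... | no  _ = refl

  record Span (d : ℕ) (p : Poly) : Set (c ⊔ ℓ) where
    constructor mkSpan
    field
      coordinates : Fin (count d 0) → Carrier
      expansion   : p ~ lincomb coordinates (basis d)

  span-~ : ∀ {d p q} → p ~ q → Span d p → Span d q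
  span-~ p~q (mkSpan λs e) = mkSpan λs (A.trans (A.sym p~q) e)

  span-0 : ∀ {d} → Span d 0P
  span-0 {d} = mkSpan (λ _ → 0#) (≐⇒~ (mk≐ λ f → sym
    (trans (pair-lincomb (λ _ → 0#) (basis d) f) (∑-zero (λ j → 0# * pair f (basis d j)) (λ i → zeroˡ _)))))

  span-+ : ∀ {d p q} → Span d p → Span d q → Span d (p +P q)
  span-+ {d} (mkSpan λs e) (mkSpan μs e′) = mkSpan (λ j → λs j + μs j)
    (A.trans (A.+-cong e e′) (≐⇒~ (mk≐ λ f → begin
      pair f (lincomb λs (basis d) +P lincomb μs (basis d))
        ≈⟨ pair-++ f (lincomb λs (basis d)) _ ⟩
      pair f (lincomb λs (basis d)) + pair f (lincomb μs (basis d))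
        ≈⟨ +-cong (pair-lincomb λs (basis d) f) (pair-lincomb μs (basis d) f) ⟩
      ∑ (λ j → λs j * pair f (basis d j)) + ∑ (λ j → μs j * pair f (basis d j))
        ≈⟨ ∑-distrib-+ (λ j → λs j * pair f (basis d j)) (λ j → μs j * pair f (basis d j)) ⟨
      ∑ (λ j → λs j * pair f (basis d j) + μs j * pair f (basis d j))
        ≈⟨ ∑-cong (λ j → distribʳ (pair f (basis d j)) (λs j) (μs j)) ⟨
      ∑ (λ j → (λs j + μs j) * pair f (basis d j))
        ≈⟨ pair-lincomb (λ j → λs j + μs j) (basis d) f ⟨
      pair f (lincomb (λ j → λs j + μs j) (basis d)) ∎)))

  scaleP-*P : ∀ a p → scaleP a p ≐ ((a , []) ∷ []) *P p
  scaleP-*P a p .at f = begin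
    pair f (scaleP a p)                                             ≈⟨ pair-scaleP f a p ⟩
    a * pair f p                                                    ≈⟨ +-identityʳ _ ⟨
    pair (λ u → pair (λ v → f (u ++ v)) p) ((a , []) ∷ [])          ≈⟨ pair-*P f ((a , []) ∷ []) p ⟨
    pair f (((a , []) ∷ []) *P p)                                   ∎

  scaleP-cong : ∀ a {p q} → p ~ q → scaleP a p ~ scaleP a q
  scaleP-cong a {p} {q} p~q = A.trans (≐⇒~ (scaleP-*P a p))
    (A.trans (*P-congˡ ((a , []) ∷ []) p~q) (A.sym (≐⇒~ (scaleP-*P a q))))

  *P-scaleP : ∀ a p q → p *P scaleP a q ≐ scaleP a (p *P q)
  *P-scaleP a p q .at f = begin
    pair f (p *P scaleP a q)                              ≈⟨ pair-*P f p (scaleP a q) ⟩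
    pair (λ u → pair (λ v → f (u ++ v)) (scaleP a q)) p   ≈⟨ pair-cong (λ u → pair-scaleP _ a q) p ⟩
    pair (λ u → a * pair (λ v → f (u ++ v)) q) p          ≈⟨ pair-* a _ p ⟩
    a * pair (λ u → pair (λ v → f (u ++ v)) q) p          ≈⟨ *-congˡ (pair-*P f p q) ⟨
    a * pair f (p *P q)                                   ≈⟨ pair-scaleP f a (p *P q) ⟨
    pair f (scaleP a (p *P q))                            ∎

  span-scale : ∀ {d p} a → Span d p → Span d (scaleP a p)
  span-scale {d} a (mkSpan λs e) = mkSpan (λ j → a * λs j)
    (A.trans (scaleP-cong a e) (≐⇒~ (mk≐ λ f → begin
      pair f (scaleP a (lincomb λs (basis d)))            ≈⟨ pair-scaleP f a (lincomb λs (basis d)) ⟩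
      a * pair f (lincomb λs (basis d))                   ≈⟨ *-congˡ (pair-lincomb λs (basis d) f) ⟩
      a * ∑ (λ j → λs j * pair f (basis d j))           ≈⟨ *-distribˡ-sum a (λ j → λs j * pair f (basis d j)) ⟩
      ∑ (λ j → a * (λs j * pair f (basis d j)))         ≈⟨ ∑-cong (λ j → *-assoc a (λs j) (pair f (basis d j))) ⟨
      ∑ (λ j → (a * λs j) * pair f (basis d j))         ≈⟨ pair-lincomb (λ j → a * λs j) (basis d) f ⟨
      pair f (lincomb (λ j → a * λs j) (basis d))         ∎)))

  span-neg : ∀ {d p} → Span d p → Span d (-P p)
  span-neg {p = p} s = span-~ (≐⇒~ (mk≐ λ f →
    trans (pair-scaleP f (- 1#) p) (trans (-1*x≈-x _) (sym (pair-neg f p))))) (span-scale (- 1#) s)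

  span-word : ∀ {u} → Normal 0 u → Span (length u) (wordP u)
  span-word {u} nf = mkSpan (indicator j) (≐⇒~ (mk≐ λ f → sym (begin
    pair f (lincomb (indicator j) (basis d))              ≈⟨ pair-lincomb (indicator j) (basis d) f ⟩
    ∑ (λ i → indicator j i * pair f (basis d i))
      ≈⟨ ∑-single _ j (λ i i≢j → trans (*-congʳ (indicator-≢ i≢j)) (zeroˡ _)) ⟩
    indicator j j * pair f (basis d j)                    ≈⟨ trans (*-congʳ (indicator-≡ j)) (*-identityˡ _) ⟩
    pair f (basis d j)                                    ≡⟨ ≡.cong (λ v → pair f (wordP v)) (AnyP.lookup-index u∈) ⟨
    pair f (wordP u)                                      ∎)))
    where
    d = length u
    u∈ : u ∈ normalWords d 0
    u∈ = ∈-normalWords⁺ nf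
    j = Any.index u∈

  -- One rewriting step suffices: the condition on the tail `u` depends only on the layer of the
  -- letter before it, so both b b u and b e u are normal as soon as b u is, where e is the starred
  -- letter in the layer of b.
  letter-word : ∀ a {u} → Normal 0 u → Span (suc (length u)) (letterP a *P wordP u)
  letter-word a [] = span-word {a ∷ []} ((λ ()) ∷ [])
  letter-word a@(i , v) {b@(j , w) ∷ u} (ok ∷ nf) = cases (suc (toℕ j) ℕ.≟ toℕ i) (toℕ w ℕ.≟ 0)
    where
    X = letterP b
    Z = letterP (starred j)
    U = wordP u
    rewritten : suc (toℕ j) ≡ toℕ i → toℕ w ≢ 0 → Dec (toℕ v ≡ 0) →
      Span (suc (suc (length u))) ((letterP a *P X) *P U)
    rewritten eq w≢0 (no v≢0) = span-~
      (A.sym (A.trans (*P-congʳ U (letters-zero i j v w (≡.sym eq) v≢0 w≢0)) (A.zeroˡ U))) span-0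
    rewritten eq w≢0 (yes v≡0) = span-~ (A.sym (A.trans (*P-congʳ U (letters-star i j v w (≡.sym eq) v≡0 w≢0)) expand))
      (span-+ (span-word {b ∷ b ∷ u} ((λ ()) ∷ (λ p → contradiction p ℕP.1+n≢n) ∷ nf))
              (span-word {b ∷ starred j ∷ u} ((λ ()) ∷ (λ _ → toℕ-star j) ∷ nf)))
      where
      expand : (X *P (X +P Z)) *P U ~ (X *P (X *P U)) +P (X *P (Z *P U))
      expand = A.trans (A.*-assoc X (X +P Z) U)
        (A.trans (*P-congˡ X (A.distribʳ U X Z)) (A.distribˡ X (X *P U) (Z *P U)))

    cases : Dec (suc (toℕ j) ≡ toℕ i) → Dec (toℕ w ≡ 0) →
      Span (suc (suc (length u))) (letterP a *P wordP (b ∷ u))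
    cases (no ne)  _         = span-word {a ∷ b ∷ u} ((λ ()) ∷ (λ eq → contradiction eq ne) ∷ nf)
    cases (yes _)  (yes w≡0) = span-word {a ∷ b ∷ u} ((λ ()) ∷ (λ _ → w≡0) ∷ nf)
    cases (yes eq) (no w≢0)  = span-~ (A.*-assoc (letterP a) X U) (rewritten eq w≢0 (toℕ v ℕ.≟ 0))

  -- Every monomial arises from the empty word by putting edges in front, so spanning reduces to
  -- stability under single edges, and these are combinations of letters.
  record Stable (q : Poly) : Set (c ⊔ ℓ) where
    constructor stable
    field multiply : ∀ {d p} → Span d p → Span (suc d) (q *P p)
  open Stable

  stable-letter : ∀ a → Stable (letterP a)
  stable-letter a .multiply {d} (mkSpan λs e) = span-~ (*P-congˡ (letterP a) (A.sym e)) (go (allFin _))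
    where
    basis-step : ∀ j → Span (suc d) (letterP a *P basis d j)
    basis-step j with ∈-normalWords⁻ d (∈P.∈-lookup {xs = normalWords d 0} j)
    ... | nf , len = ≡.subst (λ k → Span (suc k) (letterP a *P basis d j)) len (letter-word a nf)
    go : ∀ js → Span (suc d) (letterP a *P concatMap (λ j → scaleP (λs j) (basis d j)) js)
    go []       = span-~ (A.sym (A.zeroʳ (letterP a))) span-0
    go (j ∷ js) = span-~ (A.sym (A.distribˡ (letterP a) (scaleP (λs j) (basis d j)) _))
      (span-+ (span-~ (A.sym (≐⇒~ (*P-scaleP (λs j) (letterP a) (basis d j)))) (span-scale (λs j) (basis-step j)))
              (go js))

  stable-~ : ∀ {q q′} → q ~ q′ → Stable q → Stable q′
  stable-~ q~q′ s .multiply {p = p} sp = span-~ (*P-congʳ p q~q′) (multiply s sp)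

  stable-+ : ∀ {q q′} → Stable q → Stable q′ → Stable (q +P q′)
  stable-+ {q} {q′} s s′ .multiply {p = p} sp = span-~ (A.sym (A.distribʳ p q q′)) (span-+ (multiply s sp) (multiply s′ sp))

  stable-neg : ∀ {q} → Stable q → Stable (-P q)
  stable-neg {q} s .multiply {p = p} sp = span-~ (AP.-‿distribˡ-* q p) (span-neg (multiply s sp))

  stable-descending : ∀ a → Stable (descending a)
  stable-descending (i , v) with toℕ v ℕ.≟ 0
  ... | yes v≡0 = ≡.subst Stable (letterP-≡0 i v v≡0) (stable-letter (i , v))
  ... | no  v≢0 = stable-~ (A.sym (descending-sum i v v≢0))
    (stable-+ (stable-letter (i , v)) (stable-letter (starred i)))

  stable-edge : ∀ e → Stable (edgeP e)
  stable-edge (i , v , w) with toℕ w ℕ.≟ 0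
  ... | yes w≡0 = ≡.subst (λ w → Stable (edgeP (i , v , w)))
    (FinP.toℕ-injective (≡.trans (toℕ-bottom i) (≡.sym w≡0))) (stable-descending (i , v))
  -- A head vertex other than number 0 cannot lie in layer 0, which has a single vertex; hence there
  -- is a layer below for a diamond.
  ... | no w≢0 with predecessor i (λ i≡0 → w≢0 (ℕP.n<1⇒n≡0 (≡.subst (λ l → toℕ w < layer m l) i≡0 (FinP.toℕ<n w))))
  ...   | j , i≡1+j = ≡.subst (λ w → Stable (edgeP (i , v , w))) (≡.subst-sym-subst i≡1+j)
    (stable-~ (A.sym (edge-linear i j i≡1+j v w′))
      (stable-+ (stable-descending (i , v))
        (stable-neg (stable-+ (stable-descending (j , w′)) (stable-neg (stable-descending (starred j)))))))
    where
    w′ = ≡.subst (λ l → Fin (layer m l)) i≡1+j w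

  span-monomial : ∀ u → Span (length u) ((1# , u) ∷ [])
  span-monomial []      = span-word []
  span-monomial (e ∷ u) = span-~ (≐⇒~ (mk≐ λ f → begin
    pair f (edgeP e *P ((1# , u) ∷ []))                             ≈⟨ pair-*P f (edgeP e) ((1# , u) ∷ []) ⟩
    pair (λ x → pair (λ v → f (x ++ v)) ((1# , u) ∷ [])) (edgeP e)  ≈⟨ pair-singleton (λ x → pair (λ v → f (x ++ v)) ((1# , u) ∷ [])) (e ∷ []) ⟩
    pair (λ v → f (e ∷ v)) ((1# , u) ∷ [])                          ≈⟨ refl ⟩
    pair f ((1# , e ∷ u) ∷ [])                                      ∎))
    (multiply (stable-edge e) (span-monomial u))

  span-homogeneous : ∀ {d} p → HomDeg d p → Span d p
  span-homogeneous []            []              = span-0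
  span-homogeneous ((a , u) ∷ p) (≡.refl ∷ hom) = span-~
    (≐⇒~ (mk≐ λ f → +-congʳ (*-congʳ (*-identityʳ a))))
    (span-+ (span-scale a (span-monomial u)) (span-homogeneous p hom))

  HomDeg-*P : ∀ {d d′} p q → HomDeg d p → HomDeg d′ q → HomDeg (d ℕ.+ d′) (p *P q)
  HomDeg-*P []            q []             hq = []
  HomDeg-*P ((a , u) ∷ p) q (≡.refl ∷ hp) hq = AllP.++⁺
    (AllP.map⁺ (All.map (λ {y} len → ≡.trans (ListP.length-++ u) (≡.cong (length u ℕ.+_) len)) hq))
    (HomDeg-*P p q hp hq)

  HomDeg-letterP : ∀ a → HomDeg 1 (letterP a)
  HomDeg-letterP (i , v) with toℕ v ℕ.≟ 0
  ... | yes _ = ≡.refl ∷ []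
  ... | no  _ = ≡.refl ∷ ≡.refl ∷ []

  HomDeg-wordP : ∀ u → HomDeg (length u) (wordP u)
  HomDeg-wordP []      = ≡.refl ∷ []
  HomDeg-wordP (a ∷ u) = HomDeg-*P (letterP a) (wordP u) (HomDeg-letterP a) (HomDeg-wordP u)

  -- The normal words are independent

  code : Letter → ℕ × ℕ
  code (i , v) = suc (toℕ i) , toℕ v

  code-injective : ∀ {a b} → code a ≡ code b → a ≡ b
  code-injective {i , v} {j , w} eq with FinP.toℕ-injective (ℕP.suc-injective (≡.cong proj₁ eq))
  ... | ≡.refl = ≡.cong (i ,_) (FinP.toℕ-injective (≡.cong proj₂ eq))

  blocked-allowed : ∀ l b → Allowed l b → blocked (suc l) (code b) ≡ false
  blocked-allowed l (j , w) ok with toℕ w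
  ... | zero  = ≡.refl
  ... | suc k with l ≡ᵇ suc (toℕ j) in eq
  ...   | false = ≡.refl
  ...   | true  = contradiction (ok (≡.sym (ℕP.≡ᵇ⇒≡ l (suc (toℕ j)) (≡.subst Bool.T (≡.sym eq) _)))) λ ()

  opE-normal : ∀ {l u} → Normal l u → ∀ f → opE (suc l) f (map code u) ≈ f ((suc l , 0) ∷ map code u)
  opE-normal []                        f = refl
  opE-normal {l} (_∷_ {a = b} ok nf) f rewrite blocked-allowed l b ok = refl

  opY-normal : ∀ {l u} k → Normal l u → k ≢ 0 → ∀ f →
    opY (suc l , k) f (map code u) ≈ f ((suc l , k) ∷ map code u)
  opY-normal zero    _                       k≢0 f = contradiction ≡.refl k≢0
  opY-normal (suc k) []                      k≢0 f = refl
  opY-normal {l} (suc k) (_∷_ {a = b} ok nf) k≢0 f rewrite blocked-allowed l b ok = refl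

  -- The head of the edge is a chosen vertex, so the last term of `opEdge` is the y numbered 0,
  -- which acts as 0.
  act-descending : ∀ i v f x →
    act (descending (i , v)) f x ≈ opE (suc (toℕ i)) f x + opY (suc (toℕ i) , toℕ v) f x
  act-descending i v f x = trans (act-edgeP (i , v , bottom i) f x)
    (trans (+-congˡ (trans (-‿cong (reflexive (≡.cong (λ k → opY (toℕ i , k) f x) (toℕ-bottom i)))) -0#≈0#))
           (+-identityʳ _))

  act-letterP : ∀ a {u} → Normal (toℕ (proj₁ a)) u → ∀ f →
    act (letterP a) f (map code u) ≈ f (code a ∷ map code u)
  act-letterP (i , v) {u} nf f with toℕ v ℕ.≟ 0
  ... | yes v≡0 = begin
    act (descending (i , v)) f x                  ≈⟨ act-descending i v f x ⟩
    opE l f x + opY (l , toℕ v) f x               ≡⟨ ≡.cong (λ k → opE l f x + opY (l , k) f x) v≡0 ⟩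
    opE l f x + 0#                                ≈⟨ +-identityʳ _ ⟩
    opE l f x                                     ≈⟨ opE-normal nf f ⟩
    f ((l , 0) ∷ x)                               ≡⟨ ≡.cong (λ k → f ((l , k) ∷ x)) v≡0 ⟨
    f ((l , toℕ v) ∷ x)                           ∎
    where
    l = suc (toℕ i)
    x = map code u
  ... | no v≢0 = begin
    act (descending (i , v) -P descending (starred i)) f x
      ≈⟨ act-minus (descending (i , v)) (descending (starred i)) f x ⟩
    act (descending (i , v)) f x - act (descending (starred i)) f x
      ≈⟨ +-cong (act-descending i v f x) (-‿cong (act-descending i (star i) f x)) ⟩
    (opE l f x + opY (l , toℕ v) f x) - (opE l f x + opY (l , toℕ (star i)) f x)
      ≈⟨ +-congˡ (-‿cong (trans (+-congˡ (reflexive (≡.cong (λ k → opY (l , k) f x) (toℕ-star i)))) (+-identityʳ _))) ⟩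
    (opE l f x + opY (l , toℕ v) f x) - opE l f x
      ≈⟨ xyx⁻¹≈y _ _ ⟩
    opY (l , toℕ v) f x
      ≈⟨ opY-normal (toℕ v) nf v≢0 f ⟩
    f ((l , toℕ v) ∷ x) ∎
    where
    l = suc (toℕ i)
    x = map code u

  -- Acting on the empty word, a normal word reproduces itself: its letters are put in front from
  -- right to left, and normality means that no rewriting rule is triggered.
  act-wordP : ∀ {l u} → Normal l u → ∀ f → act (wordP u) f [] ≈ f (map code u)
  act-wordP []                        f = pair-singleton (λ w → actWord w f []) []
  act-wordP (_∷_ {a = a} {u} ok nf) f = begin
    act (letterP a *P wordP u) f []           ≈⟨ act-*P (letterP a) (wordP u) f [] ⟩
    act (wordP u) (act (letterP a) f) []      ≈⟨ act-wordP nf (act (letterP a) f) ⟩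
    act (letterP a) f (map code u)            ≈⟨ act-letterP a nf f ⟩
    f (code a ∷ map code u)                   ∎

  _≟C_ : DecidableEquality (List (ℕ × ℕ))
  _≟C_ = ListP.≡-dec (ProductP.≡-dec ℕ._≟_ ℕ._≟_)

  δC : List (ℕ × ℕ) → Functional
  δC w x with x ≟C w
  ... | yes _ = 1#
  ... | no  _ = 0#

  δC-≡ : ∀ w → δC w w ≈ 1#
  δC-≡ w with w ≟C w
  ... | yes _ = refl
  ... | no ¬p = contradiction ≡.refl ¬p

  δC-≢ : ∀ {w x} → x ≢ w → δC w x ≈ 0#
  δC-≢ {w} {x} x≢w with x ≟C w
  ... | yes p = contradiction p x≢w
  ... | no  _ = refl

  -- An element of the ideal acts as 0, while acting on the empty word turns the combination into
  -- one of distinct words, from which `δC (codes j)` reads off the coefficient.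
  basis-independent : ∀ d (λs : Fin (count d 0) → Carrier) → Ideal (lincomb λs (basis d)) → ∀ j → λs j ≈ 0#
  basis-independent d λs p j = sym (begin
    0#                                                          ≈⟨ act-ideal p (δC (codes j)) [] ⟨
    act (lincomb λs (basis d)) (δC (codes j)) []                ≈⟨ pair-lincomb λs (basis d) _ ⟩
    ∑ (λ i → λs i * act (basis d i) (δC (codes j)) [])
      ≈⟨ ∑-cong (λ i → *-congˡ (act-wordP (proj₁ (∈-normalWords⁻ d (∈P.∈-lookup {xs = normalWords d 0} i))) (δC (codes j)))) ⟩
    ∑ (λ i → λs i * δC (codes j) (codes i))
      ≈⟨ ∑-single _ j (λ i i≢j → trans (*-congˡ (δC-≢ (i≢j ∘ codes-injective))) (zeroʳ _)) ⟩
    λs j * δC (codes j) (codes j)                               ≈⟨ *-congˡ (δC-≡ (codes j)) ⟩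
    λs j * 1#                                                   ≈⟨ *-identityʳ _ ⟩
    λs j                                                        ∎)
    where
    codes : Fin (count d 0) → List (ℕ × ℕ)
    codes i = map code (basisWord d i)
    codes-injective : ∀ {i k} → codes i ≡ codes k → i ≡ k
    codes-injective eq = Unique⇒lookup-injective (normalWords⁺ d 0) (ListP.map-injective code-injective eq)

  hasDim : ∀ d → HasDim d (count d 0)
  hasDim d = basis d , homogeneous-basis , spanning , λ λs p → basis-independent d λs (InR⇒Ideal p)
    where
    homogeneous-basis : ∀ j → HomDeg d (basis d j)
    homogeneous-basis j = ≡.subst (λ k → HomDeg k (basis d j))
      (proj₂ (∈-normalWords⁻ d (∈P.∈-lookup {xs = normalWords d 0} j))) (HomDeg-wordP (basisWord d j))
    spanning : ∀ p → HomDeg d p → Σ (Fin (count d 0) → Carrier) (λ λs → InR (p -P lincomb λs (basis d)))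
    spanning p hom with span-homogeneous p hom
    ... | mkSpan λs (mk~ r) = λs , Ideal⇒InR r

theorem5 : ∀ {c ℓ : Level} (F : Field c ℓ) (n : ℕ) (m : ℕ → ℕ) →
    1 ≤ n → (∀ i → 1 ≤ i → i ≤ n → 1 ≤ m i) →
    Σ (ℕ → ℕ) (λ h →
    (∀ d → Construction.HasDim F n m d (h d)) ×
    (∀ N → seriesProd h (Qcoeff n m) N ≡ oneMinusT N))
theorem5 F n m 1≤n pos =
  (λ d → count d 0) , Basis.hasDim F n m pos ,
  -- In length 0 there is only the empty word, which is normal for every index.
  Series.seriesProd-Qcoeff n m count (λ l → ≡.refl) count-sum count-step
  where open NormalWords n m pos
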